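{- Let $\Gamma=(V\uplus A,E,\alpha,c,\lambda)$ be a gainy marked network with all sinks marked. Then the transfer map $\phi_\Gamma\colon\mathbb{R}^V\to\mathbb{R}^V$, $$\phi_\Gamma(x)_v = x_v-\max_{v\xrightarrow{e}w}(\alpha_e x_w+c_e)\quad (v\in V),$$ is a piecewise-linear bijection with inverse $\psi_\Gamma\colon\mathbb{R}^V\to\mathbb{R}^V$ given by $$\psi_\Gamma(y)_v = \sup_{W\in\mathcal{W}_v}\Sigma(W)(y)\quad (v\in V).$$
   Context: A marked network $\Gamma=(V\uplus A,E,\alpha,c,\lambda)$ consists of a finite loop-free directed multigraph on the node set $V\uplus A$ with edge set $E$ (nodes in $A$ are called marked, nodes in $V$ unmarked), weights $\alpha_e,c_e\in\mathbb{R}$ with $\alpha_e>0$ for each edge $e\in E$, and a marking $\lambda\in\mathbb{R}^A$. For $x\in\mathbb{R}^V$ one sets $x_a:=\lambda_a$ for $a\in A$. A sink is a node without outgoing edges; "all sinks marked" means every sink lies in $A$. In the definition of $\phi_\Gamma$ the maximum is over all edges $e$ starting in $v$ (with $w$ the end node of $e$). A cycle is a finite walk $v_1\xrightarrow{e_1}v_2\to\cdots\xrightarrow{e_r}v_{r+1}=v_1$ ($r\ge 1$) with $v_1,\dots,v_r$ pairwise distinct. The weight of a finite walk with edges $e_1,\dots,e_r$ is $\prod_{i=1}^r\alpha_{e_i}$. The network is gainy if every cycle $C$ has weight $\alpha(C)<1$. $\mathcal{W}$ is the set consisting of all finite walks $v_1\xrightarrow{e_1}\cdots\xrightarrow{e_r}v_{r+1}$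 ($r\ge0$) with $v_i\in V$ for $i\le r$ and $v_{r+1}\in A$, and all infinite walks $v_1\xrightarrow{e_1}v_2\xrightarrow{e_2}\cdots$ with all $v_i\in V$. $\mathcal{W}_v$ is the set of walks in $\mathcal{W}$ starting in $v$. For $W\in\mathcal{W}$ and $x\in\mathbb{R}^V$: if $W$ is finite, $$\Sigma(W)(x)=\sum_{k=1}^r\Big(\prod_{j=1}^{k-1}\alpha_{e_j}\Big)(x_{v_k}+c_{e_k})+\Big(\prod_{j=1}^r\alpha_{e_j}\Big)x_{v_{r+1}};$$ if $W$ is infinite, $\Sigma(W)(x)=\sum_{k=1}^\infty\big(\prod_{j=1}^{k-1}\alpha_{e_j}\big)(x_{v_k}+c_{e_k})$ (for gainy networks this series converges absolutely, and for every $x$ the values $\Sigma(W)(x)$, $W\in\mathcal{W}$, are bounded above). "Piecewise-linear" means piecewise affine-linear. -}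

module Defs where

open import Algebra.Bundles using (CommutativeRing)
open import Data.Fin.Base using (Fin; toℕ)
import Data.Fin.Properties as Fin
open import Data.List.Base using (List; []; _∷_; allFin; filter; map)
open import Data.List.Membership.Propositional using (_∈_)
open import Data.List.Membership.Propositional.Properties using (∈-allFin; ∈-filter⁺)
open import Data.List.Relation.Unary.All using (All)
open import Data.List.Relation.Unary.Any using (Any)
open import Data.List.Relation.Unary.Unique.Propositional using (Unique)
import Data.List.Extrema as Extrema
open import Data.Nat.Base as ℕ using (ℕ; zero; suc)
open import Data.Product.Base using (Σ; ∃; ∃-syntax; _×_; _,_)
open import Data.Sum.Base using (_⊎_; inj₁; inj₂; [_,_]′)
import Data.Sum.Properties as Sum
open import Data.Vec.Functional using (Vector)
open import Level as Level using (Level; _⊔_) renaming (suc to lsuc)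
open import Relation.Binary.Bundles using (TotalOrder)
open import Relation.Binary.Core using (Rel)
open import Relation.Binary.Construct.Closure.ReflexiveTransitive using (Star; ε; _◅_)
open import Relation.Binary.Definitions using (DecidableEquality)
import Relation.Binary.Construct.NonStrictToStrict as NonStrictToStrict
open import Relation.Binary.PropositionalEquality.Core using (_≡_; _≢_; refl; subst)
open import Relation.Binary.Structures using (IsTotalOrder)
open import Relation.Nullary.Negation using (¬_; contradiction)
open import Relation.Unary using (Pred)

module _ {a ℓ} {A : Set a} (_≤_ : Rel A ℓ) where

  IsUpperBound : ∀ {p} → Pred A p → A → Set (a ⊔ ℓ ⊔ p)
  IsUpperBound S u = ∀ s → S s → s ≤ u

  IsSupremum : ∀ {p} → Pred A p → A → Set (a ⊔ ℓ ⊔ p)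
  IsSupremum S m = IsUpperBound S m × (∀ u → IsUpperBound S u → m ≤ u)

-- The usual axioms of the real numbers.  Classically such a structure is
-- unique up to unique isomorphism, so a statement about an arbitrary one is a
-- statement about ℝ.
record CompleteOrderedField (c ℓ₁ ℓ₂ : Level) : Set (lsuc (c ⊔ ℓ₁ ⊔ ℓ₂)) where
  field
    commutativeRing : CommutativeRing c ℓ₁

  open CommutativeRing commutativeRing public renaming (refl to ≈-refl; sym to ≈-sym; trans to ≈-trans)

  infix 4 _≤_
  field
    _≤_          : Rel Carrier ℓ₂
    isTotalOrder : IsTotalOrder _≈_ _≤_
    1≉0          : ¬ 1# ≈ 0#
    inverse      : ∀ x → ¬ x ≈ 0# → ∃[ y ] x * y ≈ 1#
    +-monoˡ-≤    : ∀ {x y} z → x ≤ y → x + z ≤ y + z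
    *-nonNeg     : ∀ {x y} → 0# ≤ x → 0# ≤ y → 0# ≤ x * y
    complete     : (S : Pred Carrier (c ⊔ ℓ₁ ⊔ ℓ₂)) →
                   ∃ S → ∃ (IsUpperBound _≤_ S) → ∃ (IsSupremum _≤_ S)

  totalOrder : TotalOrder c ℓ₁ ℓ₂
  totalOrder = record { isTotalOrder = isTotalOrder }

  open NonStrictToStrict _≈_ _≤_ public using (_<_)

module _ {c ℓ₁ ℓ₂} (ℝ : CompleteOrderedField c ℓ₁ ℓ₂) where

  open CompleteOrderedField ℝ
  open import Algebra.Properties.Monoid.Sum +-monoid using (sum)
  open import Algebra.Properties.Monoid.Sum *-monoid using () renaming (sum to product)
  open import Data.Vec.Functional.Relation.Binary.Equality.Setoid setoid public using (_≋_)

  infix 8 ℝ^_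
  ℝ^_ : ℕ → Set c
  ℝ^ n = Vector Carrier n

  ConvergesTo : (ℕ → Carrier) → Carrier → Set (c ⊔ ℓ₁ ⊔ ℓ₂)
  ConvergesTo s l = ∀ ε → 0# < ε → ∃[ N ] ∀ n → N ℕ.≤ n → (l - ε < s n) × (s n < l + ε)

  record Affine (n : ℕ) : Set c where
    field
      linear   : ℝ^ n
      constant : Carrier

    ⟦_⟧ : ℝ^ n → Carrier
    ⟦_⟧ x = sum (λ i → linear i * x i) + constant

  AffineMap : ℕ → ℕ → Set c
  AffineMap n m = Fin m → Affine n

  apply : ∀ {n m} → AffineMap n m → ℝ^ n → ℝ^ m
  apply g x j = Affine.⟦ g j ⟧ x

  -- A closed convex polyhedron, given by finitely many inequalities 0 ≤ h x.
  Polyhedron : ℕ → Set c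
  Polyhedron n = List (Affine n)

  _∈ᴾ_ : ∀ {n} → ℝ^ n → Polyhedron n → Set (c ⊔ ℓ₂)
  x ∈ᴾ P = All (λ h → 0# ≤ Affine.⟦ h ⟧ x) P

  -- Finitely many polyhedra cover the domain and the map is affine on each of
  -- them; as the pieces are closed, such a map is automatically continuous.
  PiecewiseLinear : ∀ {n m} → (ℝ^ n → ℝ^ m) → Set (c ⊔ ℓ₁ ⊔ ℓ₂)
  PiecewiseLinear {n} {m} f =
    Σ (List (Polyhedron n × AffineMap n m)) λ pieces →
      (∀ x → Any (λ (P , g) → x ∈ᴾ P) pieces) ×
      All (λ (P , g) → ∀ x → x ∈ᴾ P → f x ≋ apply g x) pieces

  maximum : (xs : List Carrier) → xs ≢ [] → Carrier
  maximum []       xs≢[] = contradiction refl xs≢[]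
  maximum (x ∷ xs) _     = Extrema.max totalOrder x xs

  record MarkedNetwork : Set (c ⊔ ℓ₁ ⊔ ℓ₂) where
    field
      #V #A #E : ℕ

    V : Set
    V = Fin #V

    A : Set
    A = Fin #A

    E : Set
    E = Fin #E

    Node : Set
    Node = V ⊎ A

    field
      source target : E → Node
      loopFree      : ∀ e → source e ≢ target e
      α γ           : E → Carrier   -- γ e is the additive weight c_e
      α>0           : ∀ e → 0# < α e
      marking       : ℝ^ #A

    Marked Unmarked : Node → Set
    Marked   u = ∃[ a ] u ≡ inj₂ a
    Unmarked u = ∃[ v ] u ≡ inj₁ v

    IsSink : Node → Set
    IsSink u = ∀ e → source e ≢ u

    AllSinksMarked : Set
    AllSinksMarked = ∀ u → IsSink u → Marked u

    extend : ℝ^ #V → Node → Carrier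
    extend x = [ x , marking ]′

    infix 4 _⟶_
    _⟶_ : Rel Node Level.zero
    u ⟶ w = ∃[ e ] source e ≡ u × target e ≡ w

    Walk : Rel Node Level.zero
    Walk = Star _⟶_

    -- v₁, …, v_r for a walk v₁ → ⋯ → v_{r+1}
    startNodes : ∀ {u w} → Walk u w → List Node
    startNodes ε                 = []
    startNodes (_◅_ {i = u} _ W) = u ∷ startNodes W

    weight : ∀ {u w} → Walk u w → Carrier
    weight ε             = 1#
    weight ((e , _) ◅ W) = α e * weight W

    IsCycle : ∀ {u} → Walk u u → Set
    IsCycle W = startNodes W ≢ [] × Unique (startNodes W)

    Gainy : Set (ℓ₁ ⊔ ℓ₂)
    Gainy = ∀ {u} (C : Walk u u) → IsCycle C → weight C < 1#

    record InfiniteWalk (u : Node) : Set where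
      field
        node  : ℕ → V
        start : inj₁ (node 0) ≡ u
        step  : ∀ k → inj₁ (node k) ⟶ inj₁ (node (suc k))

      edge : ℕ → E
      edge k = let (e , _) = step k in e

    data 𝒲 (u : Node) : Set where
      finite   : ∀ {a} (W : Walk u (inj₂ a)) → All Unmarked (startNodes W) → 𝒲 u
      infinite : InfiniteWalk u → 𝒲 u

    -- The accumulator p is the product of the α over the edges already passed.
    finiteΣ : ∀ {u w} → ℝ^ #V → Carrier → Walk u w → Carrier
    finiteΣ {w = w} x p ε                         = p * extend x w
    finiteΣ         x p (_◅_ {i = u} (e , _) W) =
      p * (extend x u + γ e) + finiteΣ x (p * α e) W

    partialΣ : ∀ {u} → ℝ^ #V → InfiniteWalk u → ℕ → Carrier
    partialΣ x W n = sum {n} λ k →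
      product {toℕ k} (λ j → α (edge (toℕ j))) * (x (node (toℕ k)) + γ (edge (toℕ k)))
      where open InfiniteWalk W

    -- HasΣ x W s : the (possibly infinite) sum Σ(W)(x) has the value s.
    data HasΣ {u} (x : ℝ^ #V) : 𝒲 u → Carrier → Set (c ⊔ ℓ₁ ⊔ ℓ₂) where
      finite   : ∀ {a s} {W : Walk u (inj₂ a)} {unmarked} →
                 finiteΣ x 1# W ≈ s → HasΣ x (finite W unmarked) s
      infinite : ∀ {W s} → ConvergesTo (partialΣ x W) s → HasΣ x (infinite W) s

    _≟_ : DecidableEquality Node
    _≟_ = Sum.≡-dec Fin._≟_ Fin._≟_

    outgoing : Node → List E
    outgoing u = filter (λ e → source e ≟ u) (allFin #E)

    outgoing≢[] : AllSinksMarked → ∀ v → outgoing (inj₁ v) ≢ []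
    outgoing≢[] sinks v none with sinks (inj₁ v) isSink
      where
      isSink : IsSink (inj₁ v)
      isSink e e∈v with subst (e ∈_) none (∈-filter⁺ (λ e → source e ≟ inj₁ v) (∈-allFin e) e∈v)
      ... | ()
    ... | _ , ()

    edgeValue : ℝ^ #V → E → Carrier
    edgeValue x e = α e * extend x (target e) + γ e

    transfer : AllSinksMarked → ℝ^ #V → ℝ^ #V
    transfer sinks x v = x v - maximum (map (edgeValue x) (outgoing (inj₁ v))) nonEmpty
      where
      nonEmpty : map (edgeValue x) (outgoing (inj₁ v)) ≢ []
      nonEmpty with outgoing (inj₁ v) | outgoing≢[] sinks v
      ... | []    | ne = λ _ → ne refl
      ... | _ ∷ _ | _  = λ ()

{-# OPTIONS --safe #-}
module Submission where

-- Loop erasure turns gainyness into the bound α(W) < 1 for all closed walks W of positive length.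
-- Eliminating the nodes one after the other (max-plus Gaussian elimination, i.e. Fourier–Motzkin)
-- then produces a potential q ≥ 1 on all nodes with 1 + α_e q(w) ≤ q(u) for every edge e : u → w.
-- The potential does all the analysis.  It bounds the sums of the products of the α along walks, so
-- the series converge and the values Σ(W)(y) have a common bound.  It also gives a maximum
-- principle: if d_v ≤ α_e d_w for some edge e : v → w at each v, and d ≤ 0 on A, then d ≤ 0;
-- applied to x − x′ with e an edge attaining the maximum for x, this makes φ injective.
-- Splitting off the first edge of a walk shows ψ_v = y_v + max (α_e ψ_w + c_e), i.e. φ (ψ y) = y,
-- and with injectivity this is all that is needed.

open import Defs
open import Algebra.Bundles using (CommutativeRing)
import Algebra.Properties.Monoid.Sum as MonoidSum
import Algebra.Properties.Ring as RingProperties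
import Algebra.Properties.Semiring.Mult.TCOptimised as SemiringMult
import Algebra.Properties.Semiring.Sum as SemiringSum
import Algebra.Solver.Ring as RingSolver
open import Algebra.Solver.Ring.AlmostCommutativeRing using (_-Raw-AlmostCommutative⟶_; fromCommutativeRing)
import Algebra.Solver.Ring.NaturalCoefficients.Default as SemiringSolver
open import Axiom.ExcludedMiddle using (ExcludedMiddle)
open import Data.Fin.Base using (Fin; zero; suc; toℕ; splitAt; join)
import Data.Fin.Properties as Fin
open import Data.Integer.Base as ℤ using (ℤ; +_; -[1+_]; +[1+_]; _⊖_; _◃_)
import Data.Integer.Properties as ℤ
open import Data.List.Base using (List; []; _∷_; _++_; map; allFin; cartesianProductWith)
import Data.List.Extrema as Extrema
import Data.List.Membership.DecPropositional as DecMembership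
open import Data.List.Membership.Propositional using (_∈_; lose)
open import Data.List.Membership.Propositional.Properties using (∈-map⁺; ∈-map⁻; ∈-filter⁺; ∈-filter⁻; ∈-allFin)
open import Data.List.Relation.Binary.Subset.Propositional using (_⊆_)
open import Data.List.Relation.Binary.Subset.Propositional.Properties using (All-resp-⊇)
open import Data.List.Relation.Unary.All as All using (All; []; _∷_)
import Data.List.Relation.Unary.All.Properties as All
open import Data.List.Relation.Unary.AllPairs using ([]; _∷_)
open import Data.List.Relation.Unary.Any using (Any; here; there)
import Data.List.Relation.Unary.Any.Properties as Any
open import Data.List.Relation.Unary.Unique.Propositional using (Unique)
open import Data.Maybe.Base using (Maybe; just; nothing)
open import Data.Nat.Base as ℕ using (ℕ; zero; suc; z≤n; s≤s)
import Data.Nat.Properties as ℕ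
open import Data.Product.Base using (Σ; Σ-syntax; ∃; _×_; _,_; proj₁; proj₂)
import Data.Sign.Base as Sign
open import Data.Sum.Base using (_⊎_; inj₁; inj₂; [_,_]′)
import Data.Vec.Functional as Vector
import Data.Vec.Functional.Relation.Binary.Equality.Setoid as Equality
open import Function.Base using (_∘_; flip)
open import Function.Structures using (IsBijection; IsInverse)
open import Level using (Lift; lift; lower; _⊔_)
open import Relation.Binary.Construct.Closure.ReflexiveTransitive using (ε; _◅_)
import Relation.Binary.Construct.NonStrictToStrict as NonStrictToStrict
open import Relation.Binary.Core using (Rel)
open import Relation.Binary.Definitions using (Total)
open import Relation.Binary.PropositionalEquality.Core as ≡ using (_≡_; _≢_; refl)
import Relation.Binary.PropositionalEquality.Properties as ≡
import Relation.Binary.Reasoning.Setoid as SetoidReasoning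
open import Relation.Binary.Structures using (IsTotalOrder)
open import Relation.Nullary.Decidable using (Dec; yes; no; map′)
open import Relation.Nullary.Negation using (¬_; contradiction)

-- A ring solver with integer coefficients

module IntegerCoefficients {c ℓ} (R : CommutativeRing c ℓ) where

  open CommutativeRing R renaming (refl to ≈-refl; sym to ≈-sym; trans to ≈-trans)
  open RingProperties ring
    using (-0#≈0#; -‿involutive; -‿distribˡ-*; -‿distribʳ-*; -‿+-comm)
  open SemiringMult semiring using (×-homo-+; ×1-homo-*; 1+×) renaming (_×_ to _·_)
  open SemiringSolver commutativeSemiring using (solve; _:=_; _:+_)
  open SetoidReasoning setoid

  -- The multiples are the optimised ones, for which `1 · 1#` reduces to `1#`; so the constants `:0`
  -- and `:1` denote `0#` and `1#` themselves.
  ⟦_⟧ : ℤ → Carrier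
  ⟦ + n ⟧      = n · 1#
  ⟦ -[1+ n ] ⟧ = - (suc n · 1#)

  -‿homo : ∀ i → ⟦ ℤ.- i ⟧ ≈ - ⟦ i ⟧
  -‿homo -[1+ n ] = ≈-sym (-‿involutive _)
  -‿homo (+ 0)    = ≈-sym -0#≈0#
  -‿homo +[1+ n ] = ≈-refl

  ⊖-homo : ∀ m n → ⟦ m ⊖ n ⟧ ≈ m · 1# - n · 1#
  ⊖-homo zero    zero    = ≈-sym (-‿inverseʳ 0#)
  ⊖-homo zero    (suc n) = ≈-sym (+-identityˡ _)
  ⊖-homo (suc m) zero    = ≈-sym (≈-trans (+-congˡ -0#≈0#) (+-identityʳ _))
  ⊖-homo (suc m) (suc n) = begin
    ⟦ suc m ⊖ suc n ⟧                  ≡⟨ ≡.cong ⟦_⟧ (ℤ.[1+m]⊖[1+n]≡m⊖n m n) ⟩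
    ⟦ m ⊖ n ⟧                          ≈⟨ ⊖-homo m n ⟩
    M - N                              ≈⟨ +-identityˡ _ ⟨
    0# + (M - N)                       ≈⟨ +-congʳ (-‿inverseʳ 1#) ⟨
    (1# - 1#) + (M - N)                ≈⟨ solve 4 (λ a b c d → (a :+ b) :+ (c :+ d) := (a :+ c) :+ (b :+ d)) ≈-refl 1# (- 1#) M (- N) ⟩
    (1# + M) + (- 1# + - N)            ≈⟨ +-cong (≈-sym (1+× m 1#)) (≈-trans (-‿+-comm 1# N) (-‿cong (≈-sym (1+× n 1#)))) ⟩
    suc m · 1# - suc n · 1#            ∎
    where
    M = m · 1#
    N = n · 1#

  +-homo : ∀ i j → ⟦ i ℤ.+ j ⟧ ≈ ⟦ i ⟧ + ⟦ j ⟧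
  +-homo (+ m)    (+ n)    = ×-homo-+ 1# m n
  +-homo (+ m)    -[1+ n ] = ⊖-homo m (suc n)
  +-homo -[1+ m ] (+ n)    = ≈-trans (⊖-homo n (suc m)) (+-comm _ _)
  +-homo -[1+ m ] -[1+ n ] = begin
    - (suc (suc (m ℕ.+ n)) · 1#)       ≡⟨ ≡.cong (λ k → - (k · 1#)) (ℕ.+-suc (suc m) n) ⟨
    - ((suc m ℕ.+ suc n) · 1#)         ≈⟨ -‿cong (×-homo-+ 1# (suc m) (suc n)) ⟩
    - (suc m · 1# + suc n · 1#)        ≈⟨ -‿+-comm _ _ ⟨
    - (suc m · 1#) + - (suc n · 1#)    ∎

  +◃-homo : ∀ n → ⟦ Sign.+ ◃ n ⟧ ≈ n · 1#
  +◃-homo n = reflexive (≡.cong ⟦_⟧ (ℤ.+◃n≡+n n))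

  -◃-homo : ∀ n → ⟦ Sign.- ◃ n ⟧ ≈ - (n · 1#)
  -◃-homo n = ≈-trans (reflexive (≡.cong ⟦_⟧ (ℤ.-◃n≡-n n))) (-‿homo (+ n))

  *-homo : ∀ i j → ⟦ i ℤ.* j ⟧ ≈ ⟦ i ⟧ * ⟦ j ⟧
  *-homo (+ m)    (+ n)    = ≈-trans (+◃-homo (m ℕ.* n)) (×1-homo-* m n)
  *-homo (+ m)    -[1+ n ] = ≈-trans (-◃-homo (m ℕ.* suc n))
    (≈-trans (-‿cong (×1-homo-* m (suc n))) (-‿distribʳ-* _ _))
  *-homo -[1+ m ] (+ n)    = ≈-trans (-◃-homo (suc m ℕ.* n))
    (≈-trans (-‿cong (×1-homo-* (suc m) n)) (-‿distribˡ-* _ _))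
  *-homo -[1+ m ] -[1+ n ] = ≈-trans (+◃-homo (suc m ℕ.* suc n))
    (≈-trans (×1-homo-* (suc m) (suc n)) (≈-trans (≈-sym (-‿involutive _))
      (≈-trans (-‿cong (-‿distribˡ-* _ _)) (-‿distribʳ-* _ _))))

  morphism : ℤ.+-*-rawRing -Raw-AlmostCommutative⟶ fromCommutativeRing R
  morphism = record
    { ⟦_⟧ = ⟦_⟧
    ; +-homo = +-homo
    ; *-homo = *-homo
    ; -‿homo = -‿homo
    ; 0-homo = ≈-refl
    ; 1-homo = ≈-refl
    }

  _≟ᶜ_ : ∀ i j → Maybe (⟦ i ⟧ ≈ ⟦ j ⟧)
  i ≟ᶜ j with i ℤ.≟ j
  ... | yes i≡j = just (reflexive (≡.cong ⟦_⟧ i≡j))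
  ... | no _    = nothing

  open RingSolver ℤ.+-*-rawRing (fromCommutativeRing R) morphism _≟ᶜ_ public
    using (solve; _:=_; _:+_; _:*_; _:-_; :-_; con; Polynomial)

  :0 :1 : ∀ {n} → Polynomial n
  :0 = con (+ 0)
  :1 = con (+ 1)

-- With ⊑ taken to be ≤ or ≥ this replaces maxima and minima of finite families.
directed : ∀ {a ℓ p r} {A : Set a} {_⊑_ : Rel A ℓ} → Total _⊑_ →
           (P : A → Set p) → ∃ P →
           ∀ {n} (R : Fin n → A → Set r) → (∀ i {x y} → x ⊑ y → R i x → R i y) →
           (∀ i → ∃ λ x → P x × R i x) → ∃ λ x → P x × (∀ i → R i x)
directed _     P (x , px) {zero}  R up each = x , px , λ ()
directed total P base     {suc n} R up each
  with each zero | directed total P base (R ∘ suc) (up ∘ suc) (each ∘ suc)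
... | x , px , rx | y , py , ry with total x y
... | inj₁ x⊑y = y , py , λ { zero → up zero x⊑y rx ; (suc i) → ry i }
... | inj₂ y⊑x = x , px , λ { zero → rx ; (suc i) → up (suc i) y⊑x (ry i) }

-- Arithmetic of inequalities in an ordered field

module OrderedField {c ℓ₁ ℓ₂} (em : ExcludedMiddle (c ⊔ ℓ₁ ⊔ ℓ₂)) (ℝ : CompleteOrderedField c ℓ₁ ℓ₂) where

  open CompleteOrderedField ℝ hiding (zero)
  open IntegerCoefficients commutativeRing using (solve; _:=_; _:+_; _:*_; _:-_; :-_; :0; :1)
  open IsTotalOrder isTotalOrder public
    using (total; antisym; ≤-respˡ-≈; ≤-respʳ-≈)
    renaming (refl to ≤-refl; reflexive to ≤-reflexive; trans to ≤-trans)
  private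
    module < = NonStrictToStrict _≈_ _≤_

  <⇒≤ : ∀ {x y} → x < y → x ≤ y
  <⇒≤ = proj₁

  <-≤-trans : ∀ {x y z} → x < y → y ≤ z → x < z
  <-≤-trans = <.<-≤-trans ≈-sym ≤-trans antisym ≤-respʳ-≈

  ≤-<-trans : ∀ {x y z} → x ≤ y → y < z → x < z
  ≤-<-trans = <.≤-<-trans ≤-trans antisym ≤-respˡ-≈

  <⇒≱ : ∀ {x y} → x < y → ¬ y ≤ x
  <⇒≱ = <.<⇒≱ antisym

  <-respʳ-≈ : ∀ {x y z} → y ≈ z → x < y → x < z
  <-respʳ-≈ y≈z x<y = <-≤-trans x<y (≤-reflexive y≈z)

  <-respˡ-≈ : ∀ {x y z} → y ≈ z → y < x → z < x
  <-respˡ-≈ y≈z y<x = ≤-<-trans (≤-reflexive (≈-sym y≈z)) y<x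

  _≈?_ : ∀ x y → Dec (x ≈ y)
  x ≈? y = map′ lower (lift {ℓ = c ⊔ ℓ₂}) em

  ≤-<-connex : ∀ x y → x ≤ y ⊎ y < x
  ≤-<-connex x y with total x y
  ... | inj₁ x≤y = inj₁ x≤y
  ... | inj₂ y≤x with y ≈? x
  ...   | yes y≈x = inj₁ (≤-reflexive (≈-sym y≈x))
  ...   | no  y≉x = inj₂ (y≤x , y≉x)

  ≮⇒≥ : ∀ {x y} → ¬ y < x → x ≤ y
  ≮⇒≥ {x} {y} y≮x with ≤-<-connex x y
  ... | inj₁ x≤y = x≤y
  ... | inj₂ y<x = contradiction y<x y≮x

  0≤difference : ∀ {x y} → x ≤ y → 0# ≤ y - x
  0≤difference {x} x≤y = ≤-respˡ-≈ (-‿inverseʳ x) (+-monoˡ-≤ (- x) x≤y)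

  -- A linear inequality is proved by writing the difference of its sides as a
  -- sum of terms known to be nonnegative.
  ≤-by : ∀ {x y d} → 0# ≤ d → y - x ≈ d → x ≤ y
  ≤-by {x} {y} {d} 0≤d eq = ≤-respˡ-≈ (+-identityˡ x) (≤-respʳ-≈
    (≈-trans (+-congʳ (≈-sym eq)) (solve 2 (λ x y → (y :- x) :+ x := y) ≈-refl x y))
    (+-monoˡ-≤ x 0≤d))

  0<difference : ∀ {x y} → x < y → 0# < y - x
  0<difference {x} {y} (x≤y , x≉y) = 0≤difference x≤y , λ 0≈y-x → x≉y
    (≈-trans (≈-sym (+-identityˡ x)) (≈-trans (+-congʳ 0≈y-x) (solve 2 (λ x y → (y :- x) :+ x := y) ≈-refl x y)))

  +-nonNeg : ∀ {x y} → 0# ≤ x → 0# ≤ y → 0# ≤ x + y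
  +-nonNeg {x} {y} 0≤x 0≤y = ≤-trans 0≤y (≤-respˡ-≈ (+-identityˡ y) (+-monoˡ-≤ y 0≤x))

  +-pos : ∀ {x y} → 0# < x → 0# ≤ y → 0# < x + y
  +-pos {x} {y} 0<x 0≤y = <-≤-trans 0<x (≤-by 0≤y (solve 2 (λ x y → x :+ y :- x := y) ≈-refl x y))

  <-by : ∀ {x y d} → 0# < d → y - x ≈ d → x < y
  <-by {x} {y} {d} 0<d eq = ≤-by (<⇒≤ 0<d) eq , λ x≈y →
    <⇒≱ 0<d (≤-reflexive (≈-trans (≈-sym eq) (≈-trans (+-congˡ (-‿cong x≈y)) (-‿inverseʳ y))))

  *-monoʳ-≤ : ∀ {k x y} → 0# ≤ k → x ≤ y → k * x ≤ k * y
  *-monoʳ-≤ {k} {x} {y} 0≤k x≤y = ≤-by (*-nonNeg 0≤k (0≤difference x≤y))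
    (solve 3 (λ k x y → k :* y :- k :* x := k :* (y :- x)) ≈-refl k x y)

  *-monoˡ-≤ : ∀ {k x y} → 0# ≤ k → x ≤ y → x * k ≤ y * k
  *-monoˡ-≤ {k} 0≤k x≤y = ≤-respˡ-≈ (*-comm _ _) (≤-respʳ-≈ (*-comm _ _) (*-monoʳ-≤ 0≤k x≤y))

  0≤1 : 0# ≤ 1#
  0≤1 with total 0# 1#
  ... | inj₁ 0≤1 = 0≤1
  -- From `1# ≤ 0#` it follows that -1 is nonnegative, hence so is its square, which is 1.
  ... | inj₂ 1≤0 = ≤-respʳ-≈ (solve 0 ((:0 :- :1) :* (:0 :- :1) := :1) ≈-refl)
                     (*-nonNeg (0≤difference 1≤0) (0≤difference 1≤0))

  0<1 : 0# < 1#
  0<1 = 0≤1 , 1≉0 ∘ ≈-sym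

  reciprocal : ∀ {x} → 0# < x → ∃ λ y → 0# < y × x * y ≈ 1#
  reciprocal {x} 0<x with inverse x (proj₂ 0<x ∘ ≈-sym)
  ... | y , xy≈1 with ≤-<-connex y 0#
  ...   | inj₂ 0<y = y , 0<y , xy≈1
  ...   | inj₁ y≤0 = contradiction
    (≤-respˡ-≈ xy≈1 (≤-respʳ-≈ (zeroʳ x) (*-monoʳ-≤ (<⇒≤ 0<x) y≤0))) (<⇒≱ 0<1)

  *-cancelˡ-≤ : ∀ {k x y} → 0# < k → k * x ≤ k * y → x ≤ y
  *-cancelˡ-≤ {k} {x} {y} 0<k kx≤ky with reciprocal 0<k
  ... | k⁻¹ , 0<k⁻¹ , kk⁻¹≈1 = ≤-respˡ-≈ (cancel x) (≤-respʳ-≈ (cancel y) (*-monoʳ-≤ (<⇒≤ 0<k⁻¹) kx≤ky))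
    where
    cancel : ∀ z → k⁻¹ * (k * z) ≈ z
    cancel z = ≈-trans (solve 3 (λ k l z → l :* (k :* z) := k :* l :* z) ≈-refl k k⁻¹ z)
      (≈-trans (*-congʳ kk⁻¹≈1) (*-identityˡ z))

  *-monoʳ-< : ∀ {k x y} → 0# < k → x < y → k * x < k * y
  *-monoʳ-< 0<k x<y = *-monoʳ-≤ (<⇒≤ 0<k) (<⇒≤ x<y) ,
    λ kx≈ky → <⇒≱ x<y (*-cancelˡ-≤ 0<k (≤-reflexive (≈-sym kx≈ky)))

  *-pos : ∀ {x y} → 0# < x → 0# < y → 0# < x * y
  *-pos {x} 0<x 0<y = <-respˡ-≈ (zeroʳ x) (*-monoʳ-< 0<x 0<y)

  -- The witness is d / (1 + a): subtracting a times it from d leaves the witness itself, which is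
  -- positive.
  small-multiple : ∀ {a d} → 0# ≤ a → 0# < d → ∃ λ δ → 0# < δ × a * δ < d
  small-multiple {a} {d} 0≤a 0<d =
    let b , 0<b , [1+a]b≈1 = reciprocal (+-pos 0<1 0≤a)
        d≈[1+a]bd = ≈-sym (≈-trans (*-congʳ [1+a]b≈1) (*-identityˡ d))
    in b * d , *-pos 0<b 0<d , <-by (*-pos 0<b 0<d) (≈-trans (+-congʳ d≈[1+a]bd)
      (solve 3 (λ a b d → (:1 :+ a) :* b :* d :- a :* (b :* d) := b :* d) ≈-refl a b d))

  upperBound : ∀ {n} (x : Fin n → Carrier) → ∃ λ M → 0# ≤ M × (∀ i → x i ≤ M)
  upperBound x = directed total (0# ≤_) (0# , ≤-refl) (λ i → x i ≤_) (λ _ M≤M′ x≤M → ≤-trans x≤M M≤M′) each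
    where
    each : ∀ i → ∃ λ M → 0# ≤ M × x i ≤ M
    each i with total 0# (x i)
    ... | inj₁ 0≤x = x i , 0≤x , ≤-refl
    ... | inj₂ x≤0 = 0# , ≤-refl , x≤0

  1≤multiples : ∀ {n} (x : Fin n → Carrier) → (∀ i → 0# < x i) → ∃ λ K → 0# ≤ K × (∀ i → 1# ≤ K * x i)
  1≤multiples x 0<x = directed total (0# ≤_) (0# , ≤-refl) (λ i K → 1# ≤ K * x i)
    (λ i K≤K′ 1≤Kx → ≤-trans 1≤Kx (*-monoˡ-≤ (<⇒≤ (0<x i)) K≤K′))
    (λ i → let y , 0<y , xy≈1 = reciprocal (0<x i)
           in y , <⇒≤ 0<y , ≤-reflexive (≈-sym (≈-trans (*-comm y (x i)) xy≈1)))

  -- Strict potentials by elimination of indices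

  -- The entry a i j is the weight of the step from i to j, and 0 if there is none.
  pathWeight : ∀ {n} → (Fin n → Fin n → Carrier) → Fin n → List (Fin n) → Fin n → Carrier
  pathWeight a i []       j = a i j
  pathWeight a i (k ∷ ks) j = a i k * pathWeight a k ks j

  -- The Fourier-Motzkin step: the new value t is bounded below by the `from₀ j * p j` and above
  -- through `to₀ i * t < p i`. The last hypothesis makes each lower bound compatible with each
  -- upper one.
  strictPotential-step : ∀ {n} (to₀ from₀ p : Fin n → Carrier) →
    (∀ i → 0# ≤ to₀ i) → (∀ i → 0# ≤ from₀ i) → (∀ i → 0# < p i) →
    (∀ i j → to₀ i * from₀ j * p j < p i) →
    ∃ λ t → 0# < t × (∀ j → from₀ j * p j < t) × (∀ i → to₀ i * t < p i)
  strictPotential-step to₀ from₀ p 0≤to₀ 0≤from₀ 0<p h =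
    let t , (0<t , to-t<p) , from-p<t =
          -- For each lower bound there is a t that meets all the upper bounds; the largest of these
          -- t meets every lower bound too. The base value serves when there are no lower bounds.
          directed total (λ t → 0# < t × (∀ i → to₀ i * t < p i))
            (above 0# ≤-refl (λ i → <-respˡ-≈ (≈-sym (zeroʳ (to₀ i))) (0<p i)) .proj₁ ,
             above 0# ≤-refl (λ i → <-respˡ-≈ (≈-sym (zeroʳ (to₀ i))) (0<p i)) .proj₂ .proj₂)
            (λ j t → from₀ j * p j < t) (λ _ t≤t′ <t → <-≤-trans <t t≤t′)
            (λ j → let t , lo<t , P = above (from₀ j * p j) (*-nonNeg (0≤from₀ j) (<⇒≤ (0<p j)))
                                        (λ i → <-respˡ-≈ (*-assoc _ _ _) (h i j))
                   in t , P , lo<t)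
    in t , 0<t , from-p<t , to-t<p
    where
    above : ∀ lo → 0# ≤ lo → (∀ i → to₀ i * lo < p i) →
            ∃ λ t → lo < t × 0# < t × (∀ i → to₀ i * t < p i)
    above lo 0≤lo to-lo<p =
      -- Dually, every upper bound leaves room for some `lo + δ`, and the smallest of these values
      -- meets all of them.
      let t , (lo<t , 0<t) , to-t<p = directed (flip total) (λ t → lo < t × 0# < t)
            (lo + 1# , <-by 0<1 (solve 2 (λ x y → x :+ y :- x := y) ≈-refl lo 1#) ,
              ≤-<-trans 0≤lo (<-by 0<1 (solve 2 (λ x y → x :+ y :- x := y) ≈-refl lo 1#)))
            (λ i t → to₀ i * t < p i) (λ i t≥t′ <p → ≤-<-trans (*-monoʳ-≤ (0≤to₀ i) t≥t′) <p)
            (λ i → let δ , 0<δ , small = small-multiple (0≤to₀ i) (0<difference (to-lo<p i))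
                       lo<lo+δ = <-by 0<δ (solve 2 (λ x y → x :+ y :- x := y) ≈-refl lo δ)
                   in lo + δ , (lo<lo+δ , ≤-<-trans 0≤lo lo<lo+δ) , <-by (0<difference small)
                        (solve 4 (λ a x y z → z :- a :* (x :+ y) := z :- a :* x :- a :* y) ≈-refl (to₀ i) lo δ (p i)))
      in t , lo<t , 0<t , to-t<p

  binaryMax : ∀ x y → ∃ λ m → x ≤ m × y ≤ m × (m ≡ x ⊎ m ≡ y)
  binaryMax x y with total x y
  ... | inj₁ x≤y = y , x≤y , ≤-refl , inj₂ refl
  ... | inj₂ y≤x = x , ≤-refl , y≤x , inj₁ refl

  -- Elimination of the index 0: paths through 0 become direct steps.
  module Elimination {n} (a : Fin (suc n) → Fin (suc n) → Carrier) (0≤a : ∀ i j → 0# ≤ a i j) where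

    a′-max : ∀ i j → ∃ λ m → a (suc i) (suc j) ≤ m × a (suc i) zero * a zero (suc j) ≤ m ×
                     (m ≡ a (suc i) (suc j) ⊎ m ≡ a (suc i) zero * a zero (suc j))
    a′-max i j = binaryMax _ _

    a′ : Fin n → Fin n → Carrier
    a′ i j = a′-max i j .proj₁

    direct≤a′ : ∀ i j → a (suc i) (suc j) ≤ a′ i j
    direct≤a′ i j = a′-max i j .proj₂ .proj₁

    via0≤a′ : ∀ i j → a (suc i) zero * a zero (suc j) ≤ a′ i j
    via0≤a′ i j = a′-max i j .proj₂ .proj₂ .proj₁

    0≤a′ : ∀ i j → 0# ≤ a′ i j
    0≤a′ i j = ≤-trans (0≤a (suc i) (suc j)) (direct≤a′ i j)

    -- A maximum is attained, so each step of `a′` is either a direct step of `a` or a detour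
    -- through 0; writing out the detours gives a path of `a`. Hence the bound on closed paths
    -- passes from `a` to `a′`.
    expand : ∀ i ks j → ∃ λ ks′ → pathWeight a′ i ks j ≤ pathWeight a (suc i) ks′ (suc j)
    expand i [] j = [ (λ eq → [] , ≤-reflexive (reflexive eq)) , (λ eq → zero ∷ [] , ≤-reflexive (reflexive eq)) ]′
      (a′-max i j .proj₂ .proj₂ .proj₂)
    expand i (k ∷ ks) j = extendBy (a′-max i k .proj₂ .proj₂ .proj₂) (expand k ks j)
      where
      extendBy : a′ i k ≡ a (suc i) (suc k) ⊎ a′ i k ≡ a (suc i) zero * a zero (suc k) →
        (∃ λ ks′ → pathWeight a′ k ks j ≤ pathWeight a (suc k) ks′ (suc j)) →
        ∃ λ ks′ → pathWeight a′ i (k ∷ ks) j ≤ pathWeight a (suc i) ks′ (suc j)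
      extendBy (inj₁ eq) (ks′ , le) = suc k ∷ ks′ ,
        ≤-respʳ-≈ (*-congʳ (reflexive eq)) (*-monoʳ-≤ (0≤a′ i k) le)
      extendBy (inj₂ eq) (ks′ , le) = zero ∷ suc k ∷ ks′ ,
        ≤-respʳ-≈ (≈-trans (*-congʳ (reflexive eq)) (*-assoc _ _ _)) (*-monoʳ-≤ (0≤a′ i k) le)

  StrictPotential : ∀ {n} → (Fin n → Fin n → Carrier) → Set (c ⊔ ℓ₁ ⊔ ℓ₂)
  StrictPotential {n} a = Σ[ p ∈ (Fin n → Carrier) ] (∀ i → 0# < p i) × (∀ i j → a i j * p j < p i)

  -- Induction on the number of indices. A potential for `a′` satisfies the inequalities of `a`
  -- between the remaining indices, and those for two steps via 0 are the compatibility needed to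
  -- choose the value at 0.
  strictPotential : ∀ {n} (a : Fin n → Fin n → Carrier) → (∀ i j → 0# ≤ a i j) →
    (∀ i ks → pathWeight a i ks i < 1#) →
    StrictPotential a
  strictPotential {zero}  a 0≤a cycles<1 = (λ ()) , (λ ()) , (λ ())
  strictPotential {suc n} a 0≤a cycles<1 =
    addIndex (strictPotential a′ 0≤a′ λ i ks → ≤-<-trans (expand i ks i .proj₂) (cycles<1 (suc i) (expand i ks i .proj₁)))
    where
    open Elimination a 0≤a

    addTerm : ∀ {p : Fin n → Carrier} → (∀ i → 0# < p i) → (∀ i j → a′ i j * p j < p i) →
      (∃ λ t → 0# < t × (∀ j → a zero (suc j) * p j < t) × (∀ i → a (suc i) zero * t < p i)) →
      StrictPotential a
    addTerm {p} 0<p a′p<p (t , 0<t , from<t , to<p) = (t Vector.∷ p) ,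
      (λ { zero → 0<t ; (suc i) → 0<p i }) , λ
      { zero    zero    → <-respʳ-≈ (*-identityʳ t) (<-respˡ-≈ (*-comm _ _) (*-monoʳ-< 0<t (cycles<1 zero [])))
      ; zero    (suc j) → from<t j
      ; (suc i) zero    → to<p i
      ; (suc i) (suc j) → ≤-<-trans (*-monoˡ-≤ (<⇒≤ (0<p j)) (direct≤a′ i j)) (a′p<p i j)
      }

    addIndex : StrictPotential a′ →
      StrictPotential a
    addIndex (p , 0<p , a′p<p) = addTerm 0<p a′p<p
      (strictPotential-step _ _ p (λ _ → 0≤a _ _) (λ _ → 0≤a _ _) 0<p
        (λ i j → ≤-<-trans (*-monoˡ-≤ (<⇒≤ (0<p j)) (via0≤a′ i j)) (a′p<p i j)))

-- Limits and convergence of weighted series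

module Series {c ℓ₁ ℓ₂} (em : ExcludedMiddle (c ⊔ ℓ₁ ⊔ ℓ₂)) (ℝ : CompleteOrderedField c ℓ₁ ℓ₂) where

  open CompleteOrderedField ℝ hiding (zero)
  open IntegerCoefficients commutativeRing using (solve; _:=_; _:+_; _:*_; _:-_; :1)
  open OrderedField em ℝ
  open MonoidSum +-monoid using (sum)
  open MonoidSum *-monoid using () renaming (sum to product)
  open SemiringSum semiring using (*-distribˡ-sum; sum-cong-≋)

  _⟶∞_ : (ℕ → Carrier) → Carrier → Set (c ⊔ ℓ₁ ⊔ ℓ₂)
  _⟶∞_ = ConvergesTo ℝ

  ⟶∞-cong : ∀ {s s′ l} → (∀ n → s n ≈ s′ n) → s ⟶∞ l → s′ ⟶∞ l
  ⟶∞-cong s≈s′ s→l η 0<η = let N , close = s→l η 0<η in N , λ n N≤n →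
    <-respʳ-≈ (s≈s′ n) (close n N≤n .proj₁) , <-respˡ-≈ (s≈s′ n) (close n N≤n .proj₂)

  limit-≤ : ∀ {s l b} → s ⟶∞ l → (∀ n → s n ≤ b) → l ≤ b
  limit-≤ {s} {l} {b} s→l s≤b = ≮⇒≥ λ b<l →
    let N , close = s→l (l - b) (0<difference b<l)
    in <⇒≱ (<-respˡ-≈ (solve 2 (λ l b → l :- (l :- b) := b) ≈-refl l b) (close N ℕ.≤-refl .proj₁)) (s≤b N)

  limits-≤ : ∀ {s l l′} → s ⟶∞ l → s ⟶∞ l′ → l ≤ l′
  limits-≤ {s} {l} {l′} s→l s→l′ = ≮⇒≥ λ l′<l →
    separated (small-multiple (+-nonNeg 0≤1 0≤1) (0<difference l′<l))
    where
    separated : ¬ (∃ λ δ → 0# < δ × (1# + 1#) * δ < l - l′)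
    separated (δ , 0<δ , 2δ<l-l′) = <⇒≱ (<-≤-trans (below .proj₁) (<⇒≤ (above .proj₂)))
      (≤-by (<⇒≤ (0<difference 2δ<l-l′))
        (solve 3 (λ l m d → l :- d :- (m :+ d) := l :- m :- (:1 :+ :1) :* d) ≈-refl l l′ δ))
      where
      N N′ : ℕ
      N  = s→l δ 0<δ .proj₁
      N′ = s→l′ δ 0<δ .proj₁
      below = s→l δ 0<δ .proj₂ (N ℕ.+ N′) (ℕ.m≤m+n N N′)
      above = s→l′ δ 0<δ .proj₂ (N ℕ.+ N′) (ℕ.m≤n+m N′ N)

  limit-unique : ∀ {s l l′} → s ⟶∞ l → s ⟶∞ l′ → l ≈ l′
  limit-unique s→l s→l′ = antisym (limits-≤ s→l s→l′) (limits-≤ s→l′ s→l)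

  -- For a difference of two such sequences, each side of the convergence estimate takes the bound
  -- from one sequence and the approach from the other.
  ApproachedFromBelow : (ℕ → Carrier) → Carrier → Set (c ⊔ ℓ₁ ⊔ ℓ₂)
  ApproachedFromBelow s l = (∀ n → s n ≤ l) × (∀ η → 0# < η → ∃ λ N → ∀ n → N ℕ.≤ n → l - η < s n)

  -- The limit is the supremum. If no member exceeded `l - η`, this would be an upper bound below
  -- the least one; once a member exceeds it, all later ones do by monotonicity.
  increasing-sup : ∀ (s : ℕ → Carrier) {b} → (∀ {m n} → m ℕ.≤ n → s m ≤ s n) → (∀ n → s n ≤ b) →
    ∃ (ApproachedFromBelow s)
  increasing-sup s {b} s-mono s≤b = build
    (complete (λ z → Lift (c ⊔ ℓ₂) (∃ λ n → z ≈ s n)) (s 0 , lift (0 , ≈-refl))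
      (b , λ { z (lift (n , z≈sn)) → ≤-respˡ-≈ (≈-sym z≈sn) (s≤b n) }))
    where
    build : ∃ (IsSupremum _≤_ (λ z → Lift (c ⊔ ℓ₂) (∃ λ n → z ≈ s n))) → ∃ (ApproachedFromBelow s)
    build (l , upper , least) = l , (λ n → upper (s n) (lift (n , ≈-refl))) , approach
      where
      approach : ∀ η → 0# < η → ∃ λ N → ∀ n → N ℕ.≤ n → l - η < s n
      approach η 0<η with em {Lift c (∃ λ N → l - η < s N)}
      ... | yes (lift (N , l-η<sN)) = N , λ n N≤n → <-≤-trans l-η<sN (s-mono N≤n)
      ... | no ¬close = contradiction
        (least (l - η) λ { z (lift (n , z≈sn)) → ≤-respˡ-≈ (≈-sym z≈sn) (≮⇒≥ λ lt → ¬close (lift (n , lt))) })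
        (<⇒≱ (<-by 0<η (solve 2 (λ l e → l :- (l :- e) := e) ≈-refl l η)))

  -- The partial sums of t₀ + a₀ t₁ + a₀ a₁ t₂ + ⋯, in Horner form.
  partialSum : (a t : ℕ → Carrier) → ℕ → Carrier
  partialSum a t zero    = 0#
  partialSum a t (suc n) = t 0 + a 0 * partialSum (a ∘ suc) (t ∘ suc) n

  -- All terms after the first contain the factor `a 0`; taking it out leaves the same sum for the
  -- shifted sequences.
  sum≈partialSum : ∀ a t n →
    sum {n} (λ k → product {toℕ k} (λ j → a (toℕ j)) * t (toℕ k)) ≈ partialSum a t n
  sum≈partialSum a t zero    = ≈-refl
  sum≈partialSum a t (suc n) = +-cong (*-identityˡ (t 0))
    (≈-trans (sum-cong-≋ {n} {λ k → a 0 * P k * T k} {λ k → a 0 * (P k * T k)} (λ k → *-assoc (a 0) (P k) (T k)))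
      (≈-trans (≈-sym (*-distribˡ-sum {n} (a 0) (λ k → P k * T k)))
        (*-congˡ (sum≈partialSum (a ∘ suc) (t ∘ suc) n))))
    where
    P T : Fin n → Carrier
    P k = product {toℕ k} (λ j → a (suc (toℕ j)))
    T k = t (suc (toℕ k))

  -- `U` is a supersolution of the Horner recursion: the tail of the sum is at most `U 1` by
  -- induction on the shifted sequences, and `step 0` carries this over to `U 0`.
  partialSum-≤ : ∀ (a t U : ℕ → Carrier) → (∀ k → 0# ≤ a k) → (∀ k → 0# ≤ U k) → (∀ k → t k + a k * U (suc k) ≤ U k) →
    ∀ n → partialSum a t n ≤ U 0
  partialSum-≤ a t U 0≤a 0≤U step zero    = 0≤U 0
  partialSum-≤ a t U 0≤a 0≤U step (suc n) = ≤-trans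
    (≤-by (*-nonNeg (0≤a 0) (0≤difference (partialSum-≤ (a ∘ suc) (t ∘ suc) (U ∘ suc) (0≤a ∘ suc) (0≤U ∘ suc) (step ∘ suc) n)))
      (solve 4 (λ t a s u → t :+ a :* u :- (t :+ a :* s) := a :* (u :- s)) ≈-refl
        (t 0) (a 0) (partialSum (a ∘ suc) (t ∘ suc) n) (U 1)))
    (step 0)

  partialSum-nonNeg : ∀ a t → (∀ k → 0# ≤ a k) → (∀ k → 0# ≤ t k) → ∀ n → 0# ≤ partialSum a t n
  partialSum-nonNeg a t 0≤a 0≤t zero    = ≤-refl
  partialSum-nonNeg a t 0≤a 0≤t (suc n) =
    +-nonNeg (0≤t 0) (*-nonNeg (0≤a 0) (partialSum-nonNeg (a ∘ suc) (t ∘ suc) (0≤a ∘ suc) (0≤t ∘ suc) n))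

  partialSum-mono : ∀ a t → (∀ k → 0# ≤ a k) → (∀ k → 0# ≤ t k) →
    ∀ {m n} → m ℕ.≤ n → partialSum a t m ≤ partialSum a t n
  partialSum-mono a t 0≤a 0≤t {n = n} z≤n = partialSum-nonNeg a t 0≤a 0≤t n
  partialSum-mono a t 0≤a 0≤t {suc m} {suc n} (s≤s m≤n) =
    ≤-by (*-nonNeg (0≤a 0) (0≤difference (partialSum-mono (a ∘ suc) (t ∘ suc) (0≤a ∘ suc) (0≤t ∘ suc) m≤n)))
      (solve 4 (λ t a s u → t :+ a :* u :- (t :+ a :* s) := a :* (u :- s)) ≈-refl
        (t 0) (a 0) (partialSum (a ∘ suc) (t ∘ suc) m) (partialSum (a ∘ suc) (t ∘ suc) n))

  partialSum-shift : ∀ a t M n → partialSum a (λ k → t k + M) n - partialSum a (λ _ → M) n ≈ partialSum a t n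
  partialSum-shift a t M zero    = -‿inverseʳ 0#
  partialSum-shift a t M (suc n) = ≈-trans
    (solve 5 (λ t m a x y → t :+ m :+ a :* x :- (m :+ a :* y) := t :+ a :* (x :- y)) ≈-refl
      (t 0) M (a 0) (partialSum (a ∘ suc) (λ k → t (suc k) + M) n) (partialSum (a ∘ suc) (λ _ → M) n))
    (+-congˡ (*-congˡ (partialSum-shift (a ∘ suc) (t ∘ suc) M n)))

  partialSum-tail-limit : ∀ a t {l} → 0# ≤ a 0 → partialSum (a ∘ suc) (t ∘ suc) ⟶∞ l →
    partialSum a t ⟶∞ (t 0 + a 0 * l)
  partialSum-tail-limit a t {l} 0≤a₀ tail→l η 0<η = build (small-multiple 0≤a₀ 0<η)
    where
    build : (∃ λ δ → 0# < δ × a 0 * δ < η) →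
      ∃ λ N → ∀ n → N ℕ.≤ n → (t 0 + a 0 * l - η < partialSum a t n) × (partialSum a t n < t 0 + a 0 * l + η)
    -- The n-th tail sum enters the partial sum with index `suc n`, and its error is multiplied by
    -- `a 0`.
    build (δ , 0<δ , aδ<η) = suc (tail→l δ 0<δ .proj₁) , close
      where
      close : ∀ n → suc (tail→l δ 0<δ .proj₁) ℕ.≤ n →
        (t 0 + a 0 * l - η < partialSum a t n) × (partialSum a t n < t 0 + a 0 * l + η)
      close (suc n) (s≤s N≤n) = near (tail→l δ 0<δ .proj₂ n N≤n)
        where
        s = partialSum (a ∘ suc) (t ∘ suc) n
        near : (l - δ < s) × (s < l + δ) →
          (t 0 + a 0 * l - η < t 0 + a 0 * s) × (t 0 + a 0 * s < t 0 + a 0 * l + η)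
        near (below , above) =
          <-by (+-pos (0<difference aδ<η) (*-nonNeg 0≤a₀ (<⇒≤ (0<difference below))))
            (solve 6 (λ t a l s d e → t :+ a :* s :- (t :+ a :* l :- e) := e :- a :* d :+ a :* (s :- (l :- d)))
              ≈-refl (t 0) (a 0) l s δ η) ,
          <-by (+-pos (0<difference aδ<η) (*-nonNeg 0≤a₀ (<⇒≤ (0<difference above))))
            (solve 6 (λ t a l s d e → t :+ a :* l :+ e :- (t :+ a :* s) := e :- a :* d :+ a :* (l :+ d :- s))
              ≈-refl (t 0) (a 0) l s δ η)

  abstract
    -- The sequence is the difference of the partial sums for t + M and for M, which both increase.
    partialSum-converges : ∀ (a t U : ℕ → Carrier) M → (∀ k → 0# ≤ a k) → (∀ k → 0# ≤ U k) → (∀ k → 1# + a k * U (suc k) ≤ U k) →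
      0# ≤ M → (∀ k → 0# ≤ t k + M) → (∀ k → t k ≤ M) → ∃ (partialSum a t ⟶∞_)
    partialSum-converges a t U M 0≤a 0≤U 1+aU≤U 0≤M -M≤t t≤M = build
      (increasing-sup (partialSum a (λ k → t k + M)) (partialSum-mono a (λ k → t k + M) 0≤a -M≤t)
        -- A shifted term is at most twice `M`, so `(M + M) * U` is a supersolution for the first
        -- sequence; `M * U` is one for the second.
        (partialSum-≤ a (λ k → t k + M) (λ k → (M + M) * U k) 0≤a (λ k → *-nonNeg (+-nonNeg 0≤M 0≤M) (0≤U k))
          λ k → ≤-by (+-nonNeg (*-nonNeg (+-nonNeg 0≤M 0≤M) (0≤difference (1+aU≤U k))) (0≤difference (t≤M k)))
            (solve 5 (λ m t a u v → (m :+ m) :* u :- (t :+ m :+ a :* ((m :+ m) :* v)) :=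
                                    (m :+ m) :* (u :- (:1 :+ a :* v)) :+ (m :- t)) ≈-refl M (t k) (a k) (U k) (U (suc k)))))
      (increasing-sup (partialSum a (λ _ → M)) (partialSum-mono a (λ _ → M) 0≤a (λ _ → 0≤M))
        (partialSum-≤ a (λ _ → M) (λ k → M * U k) 0≤a (λ k → *-nonNeg 0≤M (0≤U k))
          λ k → ≤-by (*-nonNeg 0≤M (0≤difference (1+aU≤U k)))
            (solve 4 (λ m a u v → m :* u :- (m :+ a :* (m :* v)) := m :* (u :- (:1 :+ a :* v))) ≈-refl M (a k) (U k) (U (suc k)))))
      where
      u w : ℕ → Carrier
      u = partialSum a (λ k → t k + M)
      w = partialSum a (λ _ → M)
      build : ∃ (ApproachedFromBelow u) → ∃ (ApproachedFromBelow w) → ∃ (partialSum a t ⟶∞_)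
      build (l , u≤l , u→l) (m , w≤m , w→m) = l - m , ⟶∞-cong (partialSum-shift a t M) λ η 0<η →
        near η (u→l η 0<η) (w→m η 0<η)
        where
        near : ∀ η → (∃ λ N → ∀ n → N ℕ.≤ n → l - η < u n) → (∃ λ N → ∀ n → N ℕ.≤ n → m - η < w n) →
          ∃ λ N → ∀ n → N ℕ.≤ n → (l - m - η < u n - w n) × (u n - w n < l - m + η)
        near η (N , u-close) (N′ , w-close) = N ℕ.+ N′ , λ n N+N′≤n →
          <-by (+-pos (0<difference (u-close n (ℕ.≤-trans (ℕ.m≤m+n N N′) N+N′≤n))) (0≤difference (w≤m n)))
            (solve 5 (λ l m e u w → u :- w :- (l :- m :- e) := u :- (l :- e) :+ (m :- w)) ≈-refl l m η (u n) (w n)) ,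
          <-by (+-pos (0<difference (w-close n (ℕ.≤-trans (ℕ.m≤n+m N′ N) N+N′≤n))) (0≤difference (u≤l n)))
            (solve 5 (λ l m e u w → l :- m :+ e :- (u :- w) := w :- (m :- e) :+ (l :- u)) ≈-refl l m η (u n) (w n))

-- Walks and loop erasure

module Network {c ℓ₁ ℓ₂} (em : ExcludedMiddle (c ⊔ ℓ₁ ⊔ ℓ₂)) (ℝ : CompleteOrderedField c ℓ₁ ℓ₂)
               (Γ : MarkedNetwork ℝ) where

  open CompleteOrderedField ℝ hiding (zero)
  open IntegerCoefficients commutativeRing using (solve; _:=_; _:+_; _:*_; _:-_; :0; :1)
  open OrderedField em ℝ
  open MarkedNetwork Γ

  open DecMembership _≟_ using (_∈?_)

  nodes : ∀ {u w} → Walk u w → List Node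
  nodes {u} ε       = u ∷ []
  nodes {u} (_ ◅ W) = u ∷ nodes W

  end∈nodes : ∀ {u w} (W : Walk u w) → w ∈ nodes W
  end∈nodes ε       = here refl
  end∈nodes (_ ◅ W) = there (end∈nodes W)

  startNodes⊆nodes : ∀ {u w} (W : Walk u w) → startNodes W ⊆ nodes W
  startNodes⊆nodes (_ ◅ W) (here eq) = here eq
  startNodes⊆nodes (_ ◅ W) (there x) = there (startNodes⊆nodes W x)

  Simple : ∀ {u w} → Walk u w → Set
  Simple W = Unique (nodes W)

  -- In a simple walk the end differs from all earlier nodes, so it may be moved to the front. When
  -- an edge closes up the walk, this is the uniqueness that `IsCycle` asks for.
  end∷startNodes-unique : ∀ {u w} (W : Walk u w) → Simple W → Unique (w ∷ startNodes W)
  end∷startNodes-unique ε       _           = [] ∷ []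
  end∷startNodes-unique (_ ◅ W) (u∉W ∷ W-simple) with end∷startNodes-unique W W-simple
  ... | w∉ ∷ unique = ((All.lookup u∉W (end∈nodes W) ∘ ≡.sym) ∷ w∉) ∷
                      (All-resp-⊇ (startNodes⊆nodes W) u∉W ∷ unique)

  weight-pos : ∀ {u w} (W : Walk u w) → 0# < weight W
  weight-pos ε             = 0<1
  weight-pos ((e , _) ◅ W) = *-pos (α>0 e) (weight-pos W)

  record Split {u w} (v : Node) (W : Walk u w) : Set (c ⊔ ℓ₁) where
    field
      before        : Walk u v
      after         : Walk v w
      weight-split  : weight W ≈ weight before * weight after
      before⊆       : nodes before ⊆ nodes W
      before-simple : Simple before
      after-simple  : Simple after

  splitAtNode : ∀ {u w v} (W : Walk u w) → Simple W → v ∈ nodes W → Split v W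
  splitAtNode {u} W@ε simple (here refl) = record
    { before = ε ; after = W ; weight-split = ≈-sym (*-identityˡ _)
    ; before⊆ = λ { (here eq) → here eq } ; before-simple = [] ∷ [] ; after-simple = simple }
  splitAtNode {u} W@(_ ◅ _) simple (here refl) = record
    { before = ε ; after = W ; weight-split = ≈-sym (*-identityˡ _)
    ; before⊆ = λ { (here eq) → here eq } ; before-simple = [] ∷ [] ; after-simple = simple }
  splitAtNode (s@(e , _) ◅ W) (u∉W ∷ simple) (there v∈W) = record
    { before = s ◅ before ; after = after
    ; weight-split = ≈-trans (*-congˡ weight-split) (≈-sym (*-assoc _ _ _))
    ; before⊆ = λ { (here eq) → here eq ; (there x) → there (before⊆ x) }
    ; before-simple = All-resp-⊇ before⊆ u∉W ∷ before-simple
    ; after-simple = after-simple }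
    where open Split (splitAtNode W simple v∈W)

  module _ (gainy : Gainy) where

    closedSimple<1 : ∀ {u w} (s : u ⟶ w) (W : Walk w u) → Simple W → α (proj₁ s) * weight W < 1#
    closedSimple<1 s W simple = gainy (s ◅ W) ((λ ()) , end∷startNodes-unique W simple)

    -- Loops are erased from the tail first. If the new starting node recurs in the erased tail, the
    -- edge and the part of the tail up to that node form a cycle of weight below 1, and dropping it
    -- cannot lower the total weight.
    eraseLoops : ∀ {u w} (W : Walk u w) → Σ[ W′ ∈ Walk u w ] Simple W′ × weight W ≤ weight W′
    eraseLoops ε = ε , [] ∷ [] , ≤-refl
    eraseLoops {u} (s@(e , _) ◅ W) = prepend (eraseLoops W)
      where
      prepend : Σ[ W′ ∈ Walk _ _ ] Simple W′ × weight W ≤ weight W′ →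
                Σ[ W′ ∈ Walk u _ ] Simple W′ × α e * weight W ≤ weight W′
      prepend (W′ , simple , W≤W′) with u ∈? nodes W′
      ... | no u∉W′ = s ◅ W′ , All.¬Any⇒All¬ _ u∉W′ ∷ simple , *-monoʳ-≤ (<⇒≤ (α>0 e)) W≤W′
      ... | yes u∈W′ = after , after-simple ,
        ≤-trans (*-monoʳ-≤ (<⇒≤ (α>0 e)) W≤W′)
          (≤-respˡ-≈ (≈-sym (≈-trans (*-congˡ weight-split) (≈-sym (*-assoc _ _ _))))
            (≤-respʳ-≈ (*-identityˡ _)
              (*-monoˡ-≤ (<⇒≤ (weight-pos after)) (<⇒≤ (closedSimple<1 s before before-simple)))))
        where open Split (splitAtNode W′ simple u∈W′)

    -- The first edge is kept apart from the erasure, so the reduced closed walk still has an edge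
    -- and is a genuine cycle.
    closed<1 : ∀ {u w} (s : u ⟶ w) (W : Walk w u) → α (proj₁ s) * weight W < 1#
    closed<1 s@(e , _) W =
      let W′ , simple , W≤W′ = eraseLoops W
      in ≤-<-trans (*-monoʳ-≤ (<⇒≤ (α>0 e)) W≤W′) (closedSimple<1 s W′ simple)

  -- The weight matrix of the network and its potential

  -- Parallel edges are replaced by their maximum, with 0 standing for a missing edge. An edge
  -- attaining the maximum is kept, since paths of the matrix have to be turned back into walks.
  heaviestEdge : ∀ u w → ∃ λ m → (0# ≤ m × (m ≈ 0# ⊎ Σ[ s ∈ u ⟶ w ] m ≈ α (proj₁ s))) ×
                                 (∀ e → source e ≡ u → target e ≡ w → α e ≤ m)
  heaviestEdge u w = directed total _ (0# , ≤-refl , inj₁ ≈-refl)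
    (λ e m → source e ≡ u → target e ≡ w → α e ≤ m) (λ _ m≤m′ h p q → ≤-trans (h p q) m≤m′) each
    where
    each : ∀ e → ∃ λ m → (0# ≤ m × (m ≈ 0# ⊎ Σ[ s ∈ u ⟶ w ] m ≈ α (proj₁ s))) ×
                         (source e ≡ u → target e ≡ w → α e ≤ m)
    each e with source e ≟ u | target e ≟ w
    ... | yes p | yes q = α e , (<⇒≤ (α>0 e) , inj₂ ((e , p , q) , ≈-refl)) , λ _ _ → ≤-refl
    ... | no ¬p | _     = 0# , (≤-refl , inj₁ ≈-refl) , λ p → contradiction p ¬p
    ... | yes _ | no ¬q = 0# , (≤-refl , inj₁ ≈-refl) , λ _ q → contradiction q ¬q

  nodeAt : Fin (#V ℕ.+ #A) → Node
  nodeAt = splitAt #V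

  entry : Fin (#V ℕ.+ #A) → Fin (#V ℕ.+ #A) → Carrier
  entry i j = heaviestEdge (nodeAt i) (nodeAt j) .proj₁

  0≤entry : ∀ i j → 0# ≤ entry i j
  0≤entry i j = heaviestEdge (nodeAt i) (nodeAt j) .proj₂ .proj₁ .proj₁

  HasWalk : Node → Node → Carrier → Set ℓ₂
  HasWalk u w x = ∃ λ v → Σ[ s ∈ u ⟶ v ] Σ[ W ∈ Walk v w ] x ≤ α (proj₁ s) * weight W

  -- A path that uses a missing edge has weight 0; otherwise its entries come from consecutive
  -- edges. Either way the weight of a closed path is below 1.
  pathWalk : ∀ i ks j → pathWeight entry i ks j ≤ 0# ⊎ HasWalk (nodeAt i) (nodeAt j) (pathWeight entry i ks j)
  pathWalk i [] j = single (heaviestEdge (nodeAt i) (nodeAt j) .proj₂ .proj₁ .proj₂)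
    where
    single : ∀ {m u w} → m ≈ 0# ⊎ (Σ[ s ∈ u ⟶ w ] m ≈ α (proj₁ s)) → m ≤ 0# ⊎ HasWalk u w m
    single (inj₁ m≈0)       = inj₁ (≤-reflexive m≈0)
    single (inj₂ (s , m≈α)) = inj₂ (_ , s , ε , ≤-reflexive (≈-trans m≈α (≈-sym (*-identityʳ _))))
  pathWalk i (k ∷ ks) j = prepend (heaviestEdge (nodeAt i) (nodeAt k) .proj₂ .proj₁) (pathWalk k ks j)
    where
    prepend : ∀ {m x u v w} → 0# ≤ m × (m ≈ 0# ⊎ Σ[ s ∈ u ⟶ v ] m ≈ α (proj₁ s)) →
              x ≤ 0# ⊎ HasWalk v w x → m * x ≤ 0# ⊎ HasWalk u w (m * x)
    prepend (0≤m , _) (inj₁ x≤0) = inj₁ (≤-respʳ-≈ (zeroʳ _) (*-monoʳ-≤ 0≤m x≤0))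
    prepend (_ , inj₁ m≈0) (inj₂ _) = inj₁ (≤-reflexive (≈-trans (*-congʳ m≈0) (zeroˡ _)))
    prepend (0≤m , inj₂ (s , m≈α)) (inj₂ (_ , s′ , W , x≤)) = inj₂
      (_ , s , s′ ◅ W , ≤-respʳ-≈ (*-congʳ m≈α) (*-monoʳ-≤ 0≤m x≤))

  -- Iterating `q-edge` along a walk shows that q at its start dominates 1 + α₁ + α₁α₂ + ⋯; `1≤q`
  -- accounts for the last product of a finite walk.
  record Potential : Set (c ⊔ ℓ₂) where
    field
      q      : Node → Carrier
      1≤q    : ∀ u → 1# ≤ q u
      q-edge : ∀ e → 1# + α e * q (target e) ≤ q (source e)

  abstract
    potential : Gainy → Potential
    potential gainy = build (strictPotential entry 0≤entry λ i ks → [ (λ ≤0 → ≤-<-trans ≤0 0<1) ,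
        (λ (_ , s , W , le) → ≤-<-trans le (closed<1 gainy s W)) ]′ (pathWalk i ks i))
      where
      build : StrictPotential entry → Potential
      build (p , 0<p , entry-p<p) = scale (1≤multiples p 0<p) (1≤multiples gap λ e → 0<difference (edge< e))
        where
        p′ : Node → Carrier
        p′ u = p (join #V #A u)

        edge< : ∀ e → α e * p′ (target e) < p′ (source e)
        edge< e = ≤-<-trans
          (*-monoˡ-≤ (<⇒≤ (0<p _)) (heaviestEdge _ _ .proj₂ .proj₂ e
            (≡.sym (Fin.splitAt-join #V #A (source e))) (≡.sym (Fin.splitAt-join #V #A (target e)))))
          (entry-p<p (join #V #A (source e)) (join #V #A (target e)))

        gap : E → Carrier
        gap e = p′ (source e) - α e * p′ (target e)

        -- The factor K lifts p to at least 1 and L lifts every gap to at least 1. Both quantities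
        -- are positive, so K + L does both at once.
        scale : (∃ λ K → 0# ≤ K × (∀ i → 1# ≤ K * p i)) → (∃ λ L → 0# ≤ L × (∀ e → 1# ≤ L * gap e)) → Potential
        scale (K , 0≤K , 1≤Kp) (L , 0≤L , 1≤Lgap) = record
          { q = λ u → (K + L) * p′ u
          ; 1≤q = λ u → ≤-trans (1≤Kp _) (*-monoˡ-≤ (<⇒≤ (0<p _)) (≤-by 0≤L
              (solve 2 (λ k l → k :+ l :- k := l) ≈-refl K L)))
          ; q-edge = λ e → ≤-by (+-nonNeg (0≤difference (1≤Lgap e)) (*-nonNeg 0≤K (<⇒≤ (0<difference (edge< e)))))
              (solve 5 (λ k l x y a → (k :+ l) :* x :- (:1 :+ a :* ((k :+ l) :* y)) :=
                          l :* (x :- a :* y) :- :1 :+ k :* (x :- a :* y))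
                ≈-refl K L (p′ (source e)) (p′ (target e)) (α e))
          }

  module _ (P : Potential) where
    open Potential P

    0<q : ∀ u → 0# < q u
    0<q u = <-≤-trans 0<1 (1≤q u)

    -- At a node where the ratio d / q is positive and maximal, the edge condition would give a larger ratio.
    maximumPrinciple : (d : Node → Carrier) → (∀ a → d (inj₂ a) ≤ 0#) →
      (∀ v → ∃ λ e → source e ≡ inj₁ v × d (inj₁ v) ≤ α e * d (target e)) →
      ∀ v → d (inj₁ v) ≤ 0#
    maximumPrinciple d d≤0 climb = conclude
      (directed total (λ r → 0# ≤ r × (r ≈ 0# ⊎ ∃ λ v → r * q (inj₁ v) ≤ d (inj₁ v))) (0# , ≤-refl , inj₁ ≈-refl)
        (λ v r → d (inj₁ v) ≤ r * q (inj₁ v)) (λ v r≤r′ le → ≤-trans le (*-monoˡ-≤ (<⇒≤ (0<q _)) r≤r′)) each)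
      where
      each : ∀ v → ∃ λ r → (0# ≤ r × (r ≈ 0# ⊎ ∃ λ v → r * q (inj₁ v) ≤ d (inj₁ v))) × d (inj₁ v) ≤ r * q (inj₁ v)
      each v = [ (λ ≤0 → 0# , (≤-refl , inj₁ ≈-refl) , ≤-respʳ-≈ (≈-sym (zeroˡ _)) ≤0) ,
                 (λ 0<d → ratio 0<d (reciprocal (0<q (inj₁ v)))) ]′ (≤-<-connex (d (inj₁ v)) 0#)
        where
        ratio : 0# < d (inj₁ v) → (∃ λ y → 0# < y × q (inj₁ v) * y ≈ 1#) → _
        ratio 0<d (y , 0<y , qy≈1) = d (inj₁ v) * y ,
          (<⇒≤ (*-pos 0<d 0<y) , inj₂ (v , ≤-reflexive eq)) , ≤-reflexive (≈-sym eq)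
          where
          eq : d (inj₁ v) * y * q (inj₁ v) ≈ d (inj₁ v)
          eq = ≈-trans (*-assoc _ _ _) (≈-trans (*-congˡ (≈-trans (*-comm _ _) qy≈1)) (*-identityʳ _))

      conclude : (∃ λ r → (0# ≤ r × (r ≈ 0# ⊎ ∃ λ v → r * q (inj₁ v) ≤ d (inj₁ v))) ×
                          (∀ v → d (inj₁ v) ≤ r * q (inj₁ v))) → ∀ v → d (inj₁ v) ≤ 0#
      conclude (r , (0≤r , attained) , d≤rq) v = ≤-trans (d≤rq v)
        (≤-respʳ-≈ (zeroˡ _) (*-monoˡ-≤ (<⇒≤ (0<q _)) (r≤0 attained)))
        where
        d≤rq′ : ∀ u → d u ≤ r * q u
        d≤rq′ (inj₁ v) = d≤rq v
        d≤rq′ (inj₂ a) = ≤-trans (d≤0 a) (*-nonNeg 0≤r (<⇒≤ (0<q _)))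

        r≤0 : (r ≈ 0# ⊎ ∃ λ v → r * q (inj₁ v) ≤ d (inj₁ v)) → r ≤ 0#
        r≤0 (inj₁ r≈0)       = ≤-reflexive r≈0
        r≤0 (inj₂ (w , rq≤d)) = drop (climb w)
          where
          drop : (∃ λ e → source e ≡ inj₁ w × d (inj₁ w) ≤ α e * d (target e)) → r ≤ 0#
          -- With u the target of e: r q(w) ≤ d(w) ≤ α d(u) ≤ α r q(u) ≤ r (q(w) - 1), hence r ≤ 0.
          drop (e , src , d≤αd) = ≤-by
            (+-nonNeg (0≤difference (≤-trans rq≤d (≤-trans d≤αd (*-monoʳ-≤ (<⇒≤ (α>0 e)) (d≤rq′ (target e))))))
              (*-nonNeg 0≤r (0≤difference (≡.subst (λ u → 1# + α e * q (target e) ≤ q u) src (q-edge e)))))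
            (solve 4 (λ r x y a → :0 :- r := a :* (r :* y) :- r :* x :+ r :* (x :- (:1 :+ a :* y)))
              ≈-refl r (q (inj₁ w)) (q (target e)) (α e))

-- Injectivity of the transfer map

module Inverse {c ℓ₁ ℓ₂} (em : ExcludedMiddle (c ⊔ ℓ₁ ⊔ ℓ₂)) (ℝ : CompleteOrderedField c ℓ₁ ℓ₂)
               (Γ : MarkedNetwork ℝ) (gainy : MarkedNetwork.Gainy Γ) (sinks : MarkedNetwork.AllSinksMarked Γ) where

  open CompleteOrderedField ℝ hiding (zero)
  open IntegerCoefficients commutativeRing using (solve; _:=_; _:+_; _:*_; _:-_; :-_; :0; :1)
  open OrderedField em ℝ
  open Series em ℝ
  open Network em ℝ Γ
  open MarkedNetwork Γ
  open Potential (potential gainy)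

  private
    0≤α : ∀ e → 0# ≤ α e
    0≤α e = <⇒≤ (α>0 e)

    0≤q : ∀ u → 0# ≤ q u
    0≤q u = ≤-trans 0≤1 (1≤q u)

  q-step : ∀ {u w} (s : u ⟶ w) → 1# + α (proj₁ s) * q w ≤ q u
  q-step (e , refl , refl) = q-edge e

  maximum-upper : ∀ xs (xs≢[] : xs ≢ []) {z} → z ∈ xs → z ≤ maximum ℝ xs xs≢[]
  maximum-upper []       xs≢[] _           = contradiction refl xs≢[]
  maximum-upper (x ∷ xs) _     (here refl) = Extrema.⊥≤max totalOrder x xs
  maximum-upper (x ∷ xs) _     (there z∈xs) = All.lookup (Extrema.xs≤max totalOrder x xs) z∈xs

  maximum-∈ : ∀ xs (xs≢[] : xs ≢ []) → maximum ℝ xs xs≢[] ∈ xs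
  maximum-∈ []       xs≢[] = contradiction refl xs≢[]
  maximum-∈ (x ∷ xs) _     = [ here , there ]′ (Extrema.argmax-sel totalOrder (λ z → z) x xs)

  ∈-outgoing⁺ : ∀ {u e} → source e ≡ u → e ∈ outgoing u
  ∈-outgoing⁺ {u} {e} src = ∈-filter⁺ (λ e → source e ≟ u) (∈-allFin e) src

  ∈-outgoing⁻ : ∀ {u e} → e ∈ outgoing u → source e ≡ u
  ∈-outgoing⁻ {u} e∈ = ∈-filter⁻ (λ e → source e ≟ u) {xs = allFin #E} e∈ .proj₂

  -- Through an edge attaining the maximum and its maximality, the transfer map can be handled
  -- without unfolding `maximum` again.
  record BestEdge (x : V → Carrier) (v : V) : Set (c ⊔ ℓ₂) where
    field
      best       : E
      source≡    : source best ≡ inj₁ v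
      transfer≡  : transfer sinks x v ≡ x v - edgeValue x best
      isMaximal  : ∀ e → source e ≡ inj₁ v → edgeValue x e ≤ edgeValue x best

  bestEdge : ∀ x v → BestEdge x v
  bestEdge x v = fromMember (∈-map⁻ (edgeValue x) (maximum-∈ values _))
    where
    values = map (edgeValue x) (outgoing (inj₁ v))
    fromMember : (∃ λ e → e ∈ outgoing (inj₁ v) × maximum ℝ values _ ≡ edgeValue x e) → BestEdge x v
    fromMember (e , e∈ , eq) = record
      { best = e ; source≡ = ∈-outgoing⁻ e∈ ; transfer≡ = ≡.cong (λ m → x v - m) eq
      ; isMaximal = λ e′ src → ≤-respʳ-≈ (reflexive eq)
          (maximum-upper values _ (∈-map⁺ (edgeValue x) (∈-outgoing⁺ src))) }

  -- Let e be best for x at v. Equal images make x - x′ at v the difference of the two maxima;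
  -- replacing the maximum for x′ by the value of e bounds it by α times the difference at the
  -- target, as the maximum principle requires.
  transfer-reflects-≤ : ∀ x x′ → (∀ v → transfer sinks x v ≈ transfer sinks x′ v) → ∀ v → x v ≤ x′ v
  transfer-reflects-≤ x x′ φx≈φx′ v = ≤-by (0≤difference (d≤0 v))
      (solve 2 (λ x y → y :- x := :0 :- (x :- y)) ≈-refl (x v) (x′ v))
    where
    d : Node → Carrier
    d u = extend x u - extend x′ u
    d≤0 : ∀ v → d (inj₁ v) ≤ 0#
    d≤0 = maximumPrinciple (potential gainy) d (λ a → ≤-reflexive (-‿inverseʳ (marking a)))
      λ v → climb v (bestEdge x v) (bestEdge x′ v)
      where
      climb : ∀ v → BestEdge x v → BestEdge x′ v → ∃ λ e → source e ≡ inj₁ v × d (inj₁ v) ≤ α e * d (target e)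
      climb v B B′ = e , source≡ B , ≤-by (0≤difference (isMaximal B′ e (source≡ B)))
        (≈-trans (+-congˡ (-‿cong d≈))
          (solve 5 (λ a x y g m → a :* (x :- y) :- (a :* x :+ g :- m) := m :- (a :* y :+ g)) ≈-refl
            (α e) (extend x (target e)) (extend x′ (target e)) (γ e) m′))
        where
        open BestEdge
        e = best B
        m = edgeValue x e
        m′ = edgeValue x′ (best B′)
        φ≈ : x v - m ≈ x′ v - m′
        φ≈ = ≈-trans (reflexive (≡.sym (transfer≡ B))) (≈-trans (φx≈φx′ v) (reflexive (transfer≡ B′)))
        d≈ : x v - x′ v ≈ m - m′
        d≈ = ≈-trans (solve 4 (λ x y m n → x :- y := (x :- m) :- y :+ m) ≈-refl (x v) (x′ v) m m′)
          (≈-trans (+-congʳ (+-congʳ φ≈)) (solve 3 (λ y m n → y :- n :- y :+ m := m :- n) ≈-refl (x′ v) m m′))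

  transfer-injective : ∀ {x x′} → (∀ v → transfer sinks x v ≈ transfer sinks x′ v) → ∀ v → x v ≈ x′ v
  transfer-injective {x} {x′} φx≈φx′ v =
    antisym (transfer-reflects-≤ x x′ φx≈φx′ v) (transfer-reflects-≤ x′ x (≈-sym ∘ φx≈φx′) v)

  extend-cong : ∀ {x x′} → (∀ v → x v ≈ x′ v) → ∀ u → extend x u ≈ extend x′ u
  extend-cong x≈x′ (inj₁ v) = x≈x′ v
  extend-cong x≈x′ (inj₂ a) = ≈-refl

  edgeValue-cong : ∀ {x x′} → (∀ v → x v ≈ x′ v) → ∀ e → edgeValue x e ≈ edgeValue x′ e
  edgeValue-cong x≈x′ e = +-congʳ (*-congˡ (extend-cong x≈x′ (target e)))

  transfer-cong : ∀ {x x′} → (∀ v → x v ≈ x′ v) → ∀ v → transfer sinks x v ≈ transfer sinks x′ v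
  transfer-cong {x} {x′} x≈x′ v = ≈-trans (reflexive (transfer≡ B))
    (≈-trans (+-cong (x≈x′ v) (-‿cong m≈m′)) (reflexive (≡.sym (transfer≡ B′))))
    where
    open BestEdge
    B = bestEdge x v
    B′ = bestEdge x′ v
    m≈m′ : edgeValue x (best B) ≈ edgeValue x′ (best B′)
    m≈m′ = antisym
      (≤-respˡ-≈ (≈-sym (edgeValue-cong x≈x′ (best B))) (isMaximal B′ (best B) (source≡ B)))
      (≤-respˡ-≈ (edgeValue-cong x≈x′ (best B′)) (isMaximal B (best B′) (source≡ B′)))

  -- Values of walks and their suprema for a fixed y

  module Values (y : V → Carrier) where

    reward : E → Carrier
    reward e = extend y (source e) + γ e

    record Bound : Set (c ⊔ ℓ₂) where
      field
        M         : Carrier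
        0≤M       : 0# ≤ M
        reward≤M  : ∀ e → reward e ≤ M
        -M≤reward : ∀ e → 0# ≤ reward e + M
        marking≤M : ∀ a → marking a ≤ M

    abstract
      bound : Bound
      bound = combine (upperBound reward) (upperBound (λ e → - reward e)) (upperBound marking)
        where
        combine : (∃ λ K → 0# ≤ K × (∀ e → reward e ≤ K)) → (∃ λ L → 0# ≤ L × (∀ e → - reward e ≤ L)) →
                  (∃ λ N → 0# ≤ N × (∀ a → marking a ≤ N)) → Bound
        combine (K , 0≤K , ≤K) (L , 0≤L , ≤L) (N , 0≤N , ≤N) = record
          { M = K + L + N
          ; 0≤M = +-nonNeg (+-nonNeg 0≤K 0≤L) 0≤N
          ; reward≤M = λ e → ≤-by (+-nonNeg (0≤difference (≤K e)) (+-nonNeg 0≤L 0≤N))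
              (solve 4 (λ k l n r → k :+ l :+ n :- r := k :- r :+ (l :+ n)) ≈-refl K L N (reward e))
          ; -M≤reward = λ e → ≤-respʳ-≈
              (solve 4 (λ k l n r → l :- (:- r) :+ (k :+ n) := r :+ (k :+ l :+ n)) ≈-refl K L N (reward e))
              (+-nonNeg (0≤difference (≤L e)) (+-nonNeg 0≤K 0≤N))
          ; marking≤M = λ a → ≤-by (+-nonNeg (0≤difference (≤N a)) (+-nonNeg 0≤K 0≤L))
              (solve 4 (λ k l n r → k :+ l :+ n :- r := n :- r :+ (k :+ l)) ≈-refl K L N (marking a))
          }

    open Bound bound

    -- The accumulator is a common factor of all terms. Extracting it turns the accumulating
    -- definition into the recursion of `finiteΣ-◅`, which matches the Horner form of the infinite
    -- case.
    finiteΣ-scale : ∀ {u w} p (W : Walk u w) → finiteΣ y p W ≈ p * finiteΣ y 1# W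
    finiteΣ-scale p ε = *-congˡ (≈-sym (*-identityˡ _))
    finiteΣ-scale {u} p ((e , _) ◅ W) = ≈-trans (+-congˡ (finiteΣ-scale (p * α e) W))
      (≈-trans (solve 4 (λ p r a s → p :* r :+ p :* a :* s := p :* (:1 :* r :+ :1 :* a :* s)) ≈-refl
                 p (extend y u + γ e) (α e) (finiteΣ y 1# W))
        (*-congˡ (+-congˡ (≈-sym (finiteΣ-scale (1# * α e) W)))))

    finiteΣ-◅ : ∀ {u v w} (s : u ⟶ v) (W : Walk v w) →
      finiteΣ y 1# (s ◅ W) ≈ extend y u + γ (proj₁ s) + α (proj₁ s) * finiteΣ y 1# W
    finiteΣ-◅ {u} (e , _) W = ≈-trans (+-congˡ (finiteΣ-scale (1# * α e) W))
      (solve 3 (λ r a s → :1 :* r :+ :1 :* a :* s := r :+ a :* s) ≈-refl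
        (extend y u + γ e) (α e) (finiteΣ y 1# W))

    reward≤M′ : ∀ {u w} (s : u ⟶ w) → extend y u + γ (proj₁ s) ≤ M
    reward≤M′ (e , refl , _) = reward≤M e

    -M≤reward′ : ∀ {u w} (s : u ⟶ w) → 0# ≤ extend y u + γ (proj₁ s) + M
    -M≤reward′ (e , refl , _) = -M≤reward e

    -- Multiplied by M, the potential inequality leaves an M to spare, which covers the reward of
    -- the edge. So `M * q` is a supersolution for finite and infinite walks alike.
    Mq-step : ∀ {u w} (s : u ⟶ w) → extend y u + γ (proj₁ s) + α (proj₁ s) * (M * q w) ≤ M * q u
    Mq-step {u} {w} s@(e , _) = ≤-by (+-nonNeg (*-nonNeg 0≤M (0≤difference (q-step s))) (0≤difference (reward≤M′ s)))
      (solve 5 (λ m u w r a → m :* u :- (r :+ a :* (m :* w)) := m :* (u :- (:1 :+ a :* w)) :+ (m :- r))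
        ≈-refl M (q u) (q w) (extend y u + γ e) (α e))

    finiteΣ-≤ : ∀ {u a} (W : Walk u (inj₂ a)) → finiteΣ y 1# W ≤ M * q u
    finiteΣ-≤ {a = a} ε = ≤-respˡ-≈ (≈-sym (*-identityˡ _)) (≤-trans (marking≤M a)
      (≤-respˡ-≈ (*-identityʳ M) (*-monoʳ-≤ 0≤M (1≤q (inj₂ a)))))
    finiteΣ-≤ {u} (_◅_ {j = w} s@(e , _) W) = ≤-respˡ-≈ (≈-sym (finiteΣ-◅ s W)) (≤-trans
      (≤-by (*-nonNeg (0≤α e) (0≤difference (finiteΣ-≤ W)))
        (solve 4 (λ r a s t → r :+ a :* t :- (r :+ a :* s) := a :* (t :- s)) ≈-refl
          (extend y u + γ e) (α e) (finiteΣ y 1# W) (M * q w)))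
      (Mq-step s))

    module _ {u} (W : InfiniteWalk u) where
      open InfiniteWalk W

      factors terms : ℕ → Carrier
      factors k = α (edge k)
      terms k   = y (node k) + γ (edge k)

      infiniteΣ : ∃ (partialSum factors terms ⟶∞_)
      infiniteΣ = partialSum-converges factors terms (λ k → q (inj₁ (node k))) M
        (λ k → 0≤α (edge k)) (λ k → 0≤q (inj₁ (node k))) (λ k → q-step (step k))
        0≤M (λ k → -M≤reward′ (step k)) (λ k → reward≤M′ (step k))

      infiniteΣ-≤ : infiniteΣ .proj₁ ≤ M * q u
      infiniteΣ-≤ = ≤-respʳ-≈ (reflexive (≡.cong (λ u → M * q u) start)) (limit-≤ (infiniteΣ .proj₂)
        (partialSum-≤ factors terms (λ k → M * q (inj₁ (node k))) (λ k → 0≤α (edge k))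
          (λ k → *-nonNeg 0≤M (0≤q (inj₁ (node k)))) (λ k → Mq-step (step k))))

    value : ∀ {u} → 𝒲 u → Carrier
    value (finite W _)  = finiteΣ y 1# W
    value (infinite W)  = infiniteΣ W .proj₁

    hasΣ : ∀ {u} (W : 𝒲 u) → HasΣ y W (value W)
    hasΣ (finite W _)  = finite ≈-refl
    hasΣ (infinite W)  = infinite (⟶∞-cong (λ n → ≈-sym (sum≈partialSum (factors W) (terms W) n)) (infiniteΣ W .proj₂))

    value-≤ : ∀ {u} (W : 𝒲 u) → value W ≤ M * q u
    value-≤ (finite W _) = finiteΣ-≤ W
    value-≤ (infinite W) = infiniteΣ-≤ W

    tail : ∀ {u} (W : InfiniteWalk u) → InfiniteWalk (inj₁ (InfiniteWalk.node W 1))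
    tail W = record { node = node ∘ suc ; start = refl ; step = step ∘ suc }
      where open InfiniteWalk W

    -- Both sides are limits of the same series. The hypothesis compares partial sums rather than
    -- walks, so that removing the first edge and adding a new one are both covered by `refl`.
    infiniteΣ-tail : ∀ {u u′} (W : InfiniteWalk u) (W′ : InfiniteWalk u′) →
      partialSum (factors W ∘ suc) (terms W ∘ suc) ≡ partialSum (factors W′) (terms W′) →
      infiniteΣ W .proj₁ ≈ terms W 0 + factors W 0 * infiniteΣ W′ .proj₁
    infiniteΣ-tail W W′ eq = limit-unique (infiniteΣ W .proj₂)
      (partialSum-tail-limit (factors W) (terms W) (0≤α _)
        (≡.subst (_⟶∞ infiniteΣ W′ .proj₁) (≡.sym eq) (infiniteΣ W′ .proj₂)))

    prependEdge : ∀ {u v w} → inj₁ v ≡ u → u ⟶ w → InfiniteWalk w → InfiniteWalk u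
    prependEdge {v = v} v≡u (e , src , tgt) W = record
      { node = λ { zero → v ; (suc k) → node k }
      ; start = v≡u
      ; step = λ { zero → e , ≡.trans src (≡.sym v≡u) , ≡.trans tgt (≡.sym start) ; (suc k) → step k } }
      where open InfiniteWalk W

    prepend : ∀ {v w} → inj₁ v ⟶ w → 𝒲 w → 𝒲 (inj₁ v)
    prepend {v} s (finite W unmarked) = finite (s ◅ W) ((v , refl) ∷ unmarked)
    prepend s (infinite W)            = infinite (prependEdge refl s W)

    value-prepend : ∀ {v w} (s : inj₁ v ⟶ w) (W : 𝒲 w) →
      value (prepend s W) ≈ y v + γ (proj₁ s) + α (proj₁ s) * value W
    value-prepend s (finite W _) = finiteΣ-◅ s W
    value-prepend s (infinite W) = infiniteΣ-tail (prependEdge refl s W) W refl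

    stop : ∀ a → 𝒲 (inj₂ a)
    stop a = finite ε []

    value-stop : ∀ a → value (stop a) ≈ marking a
    value-stop a = *-identityˡ (marking a)

    value-marked : ∀ {a} (W : 𝒲 (inj₂ a)) → value W ≈ marking a
    value-marked (finite ε _) = value-stop _
    value-marked (finite (_ ◅ _) ((_ , ()) ∷ _))
    value-marked (infinite W) = contradiction (InfiniteWalk.start W) λ ()

    record FirstEdge {v} (W : 𝒲 (inj₁ v)) : Set (c ⊔ ℓ₁) where
      field
        {next}  : Node
        edge    : inj₁ v ⟶ next
        rest    : 𝒲 next
        value≈  : value W ≈ y v + γ (proj₁ edge) + α (proj₁ edge) * value rest

    -- A finite walk in `𝒲` ends in a marked node, so from an unmarked one it has at least one edge.
    firstEdge : ∀ {v} (W : 𝒲 (inj₁ v)) → FirstEdge W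
    firstEdge (finite (s ◅ W) (_ ∷ unmarked)) = record { edge = s ; rest = finite W unmarked ; value≈ = finiteΣ-◅ s W }
    firstEdge (infinite W) = record
      { edge = let e , src , tgt = step 0 in e , ≡.trans src start , tgt
      ; rest = infinite (tail W)
      ; value≈ = ≈-trans (infiniteΣ-tail W (tail W) refl)
          (+-congʳ (+-congʳ (reflexive (≡.cong (extend y) start)))) }
      where open InfiniteWalk W

    -- If no finite walk from v reaches a marked node, then the target of any edge leaving v is
    -- unmarked and has the same defect. Such an edge exists because all sinks are marked, and
    -- following them forever gives an infinite walk.
    𝒲-nonEmpty : ∀ v → 𝒲 (inj₁ v)
    𝒲-nonEmpty v with em {Lift (c ⊔ ℓ₁ ⊔ ℓ₂) (∃ λ a → Σ[ W ∈ Walk (inj₁ v) (inj₂ a) ] All Unmarked (startNodes W))}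
    ... | yes (lift (_ , W , unmarked)) = finite W unmarked
    ... | no  stuck = infinite record
      { node = λ k → trapped k .proj₁ ; start = refl ; step = λ k → next (trapped k) .proj₂ }
      where
      Trapped : Set
      Trapped = Σ[ v ∈ V ] ¬ (∃ λ a → Σ[ W ∈ Walk (inj₁ v) (inj₂ a) ] All Unmarked (startNodes W))

      next : (t : Trapped) → Σ[ t′ ∈ Trapped ] inj₁ (proj₁ t) ⟶ inj₁ (proj₁ t′)
      next (v , stuck) = follow refl
        where
        open BestEdge (bestEdge y v)
        follow : ∀ {w} → target best ≡ w → Σ[ t′ ∈ Trapped ] inj₁ v ⟶ inj₁ (proj₁ t′)
        follow {inj₂ a} tgt = contradiction (a , (best , source≡ , tgt) ◅ ε , (v , refl) ∷ []) stuck
        follow {inj₁ w} tgt = (w , λ (a , W , unmarked) →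
          stuck (a , (best , source≡ , tgt) ◅ W , (v , refl) ∷ unmarked)) , best , source≡ , tgt

      trapped : ℕ → Trapped
      trapped zero    = v , λ W → stuck (lift W)
      trapped (suc k) = next (trapped k) .proj₁

    ValueFrom : V → Carrier → Set ℓ₁
    ValueFrom v s = ∃ λ (W : 𝒲 (inj₁ v)) → s ≈ value W

    supremum : ∀ v → ∃ (IsSupremum _≤_ (ValueFrom v))
    supremum v = unlift (complete (λ s → Lift (c ⊔ ℓ₂) (ValueFrom v s))
        (value (𝒲-nonEmpty v) , lift (𝒲-nonEmpty v , ≈-refl))
        (M * q (inj₁ v) , λ { s (lift (W , s≈)) → ≤-respˡ-≈ (≈-sym s≈) (value-≤ W) }))
      where
      unlift : ∃ (IsSupremum _≤_ (λ s → Lift (c ⊔ ℓ₂) (ValueFrom v s))) → ∃ (IsSupremum _≤_ (ValueFrom v))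
      unlift (m , upper , least) = m , (λ s s∈ → upper s (lift s∈)) , λ b isUpper → least b λ { s (lift s∈) → isUpper s s∈ }

    ψ : V → Carrier
    ψ v = supremum v .proj₁

    -- At a marked node the walk of length 0 is the only one and its value is the marking, so
    -- `extend ψ` gives the supremum at every node, marked or not.
    value≤ψ : ∀ {u} (W : 𝒲 u) → value W ≤ extend ψ u
    value≤ψ {inj₁ v} W = supremum v .proj₂ .proj₁ (value W) (W , ≈-refl)
    value≤ψ {inj₂ a} W = ≤-reflexive (value-marked W)

    ψ-least : ∀ {u b} → (∀ (W : 𝒲 u) → value W ≤ b) → extend ψ u ≤ b
    ψ-least {inj₁ v} ≤b = supremum v .proj₂ .proj₂ _ λ s (W , s≈) → ≤-respˡ-≈ (≈-sym s≈) (≤b W)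
    ψ-least {inj₂ a} ≤b = ≤-respˡ-≈ (value-stop a) (≤b (stop a))

    -- Prepending the edge to a walk from w gives a walk from v. Solving for the value of the rest,
    -- with b the reciprocal of α, bounds all walks from w at once, hence their supremum.
    edge≤ψ : ∀ {v w} (s : inj₁ v ⟶ w) → y v + (α (proj₁ s) * extend ψ w + γ (proj₁ s)) ≤ ψ v
    edge≤ψ {v} {w} s@(e , _) = conclude (reciprocal (α>0 e))
      where
      conclude : (∃ λ b → 0# < b × α e * b ≈ 1#) → y v + (α e * extend ψ w + γ e) ≤ ψ v
      conclude (b , 0<b , αb≈1) = ≤-by (0≤difference (≤-respʳ-≈ αbd≈d (*-monoʳ-≤ (0≤α e) (ψ-least rest≤))))
          (solve 5 (λ z y g a x → z :- (y :+ (a :* x :+ g)) := z :- (y :+ g) :- a :* x) ≈-refl (ψ v) (y v) (γ e) (α e) (extend ψ w))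
        where
        d = ψ v - (y v + γ e)
        αbd≈d : α e * (b * d) ≈ d
        αbd≈d = ≈-trans (≈-sym (*-assoc _ _ _)) (≈-trans (*-congʳ αb≈1) (*-identityˡ d))
        rest≤ : ∀ (W : 𝒲 w) → value W ≤ b * d
        rest≤ W = *-cancelˡ-≤ (α>0 e) (≤-respʳ-≈ (≈-sym αbd≈d)
          (≤-by (0≤difference (≤-respˡ-≈ (value-prepend s W) (value≤ψ (prepend s W))))
            (solve 4 (λ z r a x → z :- r :- a :* x := z :- (r :+ a :* x)) ≈-refl (ψ v) (y v + γ e) (α e) (value W))))

    transfer-ψ : ∀ v → transfer sinks ψ v ≈ y v
    transfer-ψ v = ≈-trans (reflexive transfer≡) (≈-trans (+-congʳ ψ≈)
        (solve 2 (λ y m → y :+ m :- m := y) ≈-refl (y v) m))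
      where
      open BestEdge (bestEdge ψ v)
      m = edgeValue ψ best

      value≤ : ∀ (W : 𝒲 (inj₁ v)) → value W ≤ y v + m
      value≤ W = viaFirst (firstEdge W)
        where
        viaFirst : FirstEdge W → value W ≤ y v + m
        viaFirst record { edge = (e , src , refl) ; rest = rest ; value≈ = value≈ } = ≤-respˡ-≈ (≈-sym value≈)
          (≤-by (+-nonNeg (0≤difference (isMaximal e src)) (*-nonNeg (0≤α e) (0≤difference (value≤ψ rest))))
            (solve 6 (λ y m g a s z → y :+ m :- (y :+ g :+ a :* s) := m :- (a :* z :+ g) :+ a :* (z :- s)) ≈-refl
              (y v) m (γ e) (α e) (value rest) (extend ψ (target e))))

      ψ≈ : ψ v ≈ y v + m
      ψ≈ = antisym (ψ-least {inj₁ v} value≤) (edge≤ψ (best , source≡ , refl))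

-- Affine functions and common refinements

module PiecewiseLinearMaps {c ℓ₁ ℓ₂} (ℝ : CompleteOrderedField c ℓ₁ ℓ₂) where

  open CompleteOrderedField ℝ hiding (zero)
  open IntegerCoefficients commutativeRing using (solve; _:=_; _:+_; _:*_; _:-_; :-_; :1)
  open MonoidSum +-monoid using (sum)
  open SemiringSum semiring using (*-distribˡ-sum; sum-cong-≋; ∑-distrib-+; sum-replicate-zero)

  ⟦_⟧ : ∀ {n} → Affine ℝ n → (Fin n → Carrier) → Carrier
  ⟦ h ⟧ = Affine.⟦_⟧ h

  IsAffine : ∀ {n} → ((Fin n → Carrier) → Carrier) → Set (c ⊔ ℓ₁)
  IsAffine {n} f = Σ[ h ∈ Affine ℝ n ] (∀ x → f x ≈ ⟦ h ⟧ x)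

  sum-0* : ∀ {n} (x : Fin n → Carrier) → sum (λ i → 0# * x i) ≈ 0#
  sum-0* {n} x = ≈-trans (sum-cong-≋ {n} {λ i → 0# * x i} {λ _ → 0#} (λ i → zeroˡ (x i))) (sum-replicate-zero n)

  const-affine : ∀ {n} k → IsAffine {n} (λ _ → k)
  const-affine k = record { linear = λ _ → 0# ; constant = k } ,
    λ x → ≈-sym (≈-trans (+-congʳ (sum-0* x)) (+-identityˡ k))

  unit : ∀ {n} → Fin n → Fin n → Carrier
  unit zero    zero    = 1#
  unit zero    (suc j) = 0#
  unit (suc i) zero    = 0#
  unit (suc i) (suc j) = unit i j

  sum-unit : ∀ {n} (i : Fin n) (x : Fin n → Carrier) → sum (λ j → unit i j * x j) ≈ x i
  sum-unit zero x = ≈-trans (+-cong (*-identityˡ _) (sum-0* (x ∘ suc))) (+-identityʳ _)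
  sum-unit (suc i) x = ≈-trans (+-cong (zeroˡ _) (sum-unit i (x ∘ suc))) (+-identityˡ _)

  coordinate-affine : ∀ {n} (i : Fin n) → IsAffine (λ x → x i)
  coordinate-affine i = record { linear = unit i ; constant = 0# } ,
    λ x → ≈-sym (≈-trans (+-identityʳ _) (sum-unit i x))

  +-affine : ∀ {n} {f g : (Fin n → Carrier) → Carrier} → IsAffine f → IsAffine g → IsAffine (λ x → f x + g x)
  +-affine {n} (h , f≈) (k , g≈) =
    record { linear = λ i → linear h i + linear k i ; constant = constant h + constant k } , λ x →
    ≈-trans (+-cong (f≈ x) (g≈ x))
      (≈-trans (solve 4 (λ a b c d → a :+ b :+ (c :+ d) := a :+ c :+ (b :+ d)) ≈-refl
                 (sum (λ i → linear h i * x i)) (constant h) (sum (λ i → linear k i * x i)) (constant k))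
        (+-congʳ (≈-sym (≈-trans
          (sum-cong-≋ {n} {λ i → (linear h i + linear k i) * x i} {λ i → linear h i * x i + linear k i * x i}
            (λ i → distribʳ (x i) (linear h i) (linear k i)))
          (∑-distrib-+ {n} (λ i → linear h i * x i) (λ i → linear k i * x i))))))
    where open Affine

  *-affine : ∀ {n} {f : (Fin n → Carrier) → Carrier} a → IsAffine f → IsAffine (λ x → a * f x)
  *-affine {n} a (h , f≈) = record { linear = λ i → a * linear h i ; constant = a * constant h } , λ x →
    ≈-trans (*-congˡ (f≈ x)) (≈-trans (distribˡ a _ _) (+-congʳ
      (≈-trans (*-distribˡ-sum {n} a (λ i → linear h i * x i))
        (sum-cong-≋ {n} {λ i → a * (linear h i * x i)} {λ i → a * linear h i * x i}
          (λ i → ≈-sym (*-assoc a (linear h i) (x i)))))))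
    where open Affine

  ∸-affine : ∀ {n} {f g : (Fin n → Carrier) → Carrier} → IsAffine f → IsAffine g → IsAffine (λ x → f x - g x)
  ∸-affine {f = f} {g} f-affine g-affine =
    let h , eq = +-affine f-affine (*-affine (- 1#) g-affine)
    in h , λ x → ≈-trans (solve 2 (λ y z → y :- z := y :+ :- :1 :* z) ≈-refl (f x) (g x)) (eq x)

  ScalarPiecewiseLinear : ∀ {n} → ((Fin n → Carrier) → Carrier) → Set (c ⊔ ℓ₁ ⊔ ℓ₂)
  ScalarPiecewiseLinear {n} f = Σ[ pieces ∈ List (Polyhedron ℝ n × Affine ℝ n) ]
    (∀ x → Any (λ (P , g) → _∈ᴾ_ ℝ x P) pieces) ×
    All (λ (P , g) → ∀ x → _∈ᴾ_ ℝ x P → f x ≈ ⟦ g ⟧ x) pieces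

  -- Common refinement: each cell of the first coordinate is intersected with each cell of the
  -- others by concatenating the inequalities. For no coordinates the whole space, given by the
  -- empty list, is the single cell.
  componentwise : ∀ {n m} (f : (Fin n → Carrier) → (Fin m → Carrier)) →
    (∀ j → ScalarPiecewiseLinear (λ x → f x j)) → PiecewiseLinear ℝ f
  componentwise {m = zero}  f _ = ([] , λ ()) ∷ [] , (λ _ → here []) , (λ _ _ ()) ∷ []
  componentwise {n} {suc m} f components =
    intersect (components zero) (componentwise (λ x → f x ∘ suc) (components ∘ suc))
    where
    combine : Polyhedron ℝ n × Affine ℝ n → Polyhedron ℝ n × AffineMap ℝ n m → Polyhedron ℝ n × AffineMap ℝ n (suc m)
    combine (P , h) (Q , g) = P ++ Q , h Vector.∷ g

    intersect : ScalarPiecewiseLinear (λ x → f x zero) → PiecewiseLinear ℝ (λ x → f x ∘ suc) → PiecewiseLinear ℝ f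
    intersect (pieces , cover , agree) (pieces′ , cover′ , agree′) =
      cartesianProductWith combine pieces pieces′ ,
      (λ x → Any.cartesianProductWith⁺ combine All.++⁺ (cover x) (cover′ x)) ,
      All.cartesianProductWith⁺ (≡.setoid _) (≡.setoid _) combine pieces pieces′ λ {(P , _)} p∈ p′∈ x x∈ → λ
        { zero    → All.lookup agree p∈ x (All.++⁻ˡ P x∈)
        ; (suc j) → All.lookup agree′ p′∈ x (All.++⁻ʳ P x∈) j }

-- Piecewise linearity of the transfer map

module Transfer {c ℓ₁ ℓ₂} (em : ExcludedMiddle (c ⊔ ℓ₁ ⊔ ℓ₂)) (ℝ : CompleteOrderedField c ℓ₁ ℓ₂)
               (Γ : MarkedNetwork ℝ) (gainy : MarkedNetwork.Gainy Γ) (sinks : MarkedNetwork.AllSinksMarked Γ) where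

  open CompleteOrderedField ℝ hiding (zero)
  open OrderedField em ℝ
  open MarkedNetwork Γ
  open Inverse em ℝ Γ gainy sinks
  open PiecewiseLinearMaps ℝ

  edgeValue-affine : ∀ e → IsAffine (λ x → edgeValue x e)
  edgeValue-affine e = +-affine (*-affine (α e) (extend-affine (target e))) (const-affine (γ e))
    where
    extend-affine : ∀ u → IsAffine (λ x → extend x u)
    extend-affine (inj₁ v) = coordinate-affine v
    extend-affine (inj₂ a) = const-affine (marking a)

  -- The cells are indexed by the edges leaving v: that of e consists of the x for which e attains
  -- the maximum. Every x lies in the cell of its best edge.
  transfer-scalarPiecewiseLinear : ∀ v → ScalarPiecewiseLinear (λ x → transfer sinks x v)
  transfer-scalarPiecewiseLinear v = map piece edges , cover , All.map⁺ (All.tabulate agree)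
    where
    edges = outgoing (inj₁ v)

    dominates : ∀ e e′ → IsAffine (λ x → edgeValue x e - edgeValue x e′)
    dominates e e′ = ∸-affine (edgeValue-affine e) (edgeValue-affine e′)

    value : ∀ e → IsAffine (λ x → x v - edgeValue x e)
    value e = ∸-affine (coordinate-affine v) (edgeValue-affine e)

    piece : E → Polyhedron ℝ #V × Affine ℝ #V
    piece e = map (λ e′ → dominates e e′ .proj₁) edges , value e .proj₁

    cover : ∀ x → Any (λ (P , g) → _∈ᴾ_ ℝ x P) (map piece edges)
    cover x = Any.map⁺ (lose (∈-outgoing⁺ source≡) (All.map⁺ (All.tabulate λ {e′} e′∈ →
      ≤-respʳ-≈ (dominates best e′ .proj₂ x) (0≤difference (isMaximal e′ (∈-outgoing⁻ e′∈))))))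
      where open BestEdge (bestEdge x v)

    agree : ∀ {e} → e ∈ edges → ∀ x → _∈ᴾ_ ℝ x (proj₁ (piece e)) → transfer sinks x v ≈ ⟦ proj₂ (piece e) ⟧ x
    agree {e} e∈ x x∈ = ≈-trans (reflexive transfer≡) (≈-trans (+-congˡ (-‿cong best≈e)) (value e .proj₂ x))
      where
      open BestEdge (bestEdge x v)
      -- Each of the two edges dominates the other, e by the inequalities of its cell.
      best≈e : edgeValue x best ≈ edgeValue x e
      best≈e = antisym
        (≤-by (All.lookup (All.map⁻ x∈) (∈-outgoing⁺ source≡)) (dominates e best .proj₂ x))
        (isMaximal e (∈-outgoing⁻ e∈))

-- Bijectivity and the inverse

theorem3p5 : ∀ {c ℓ₁ ℓ₂} → ExcludedMiddle (c ⊔ ℓ₁ ⊔ ℓ₂) →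
    (ℝ : CompleteOrderedField c ℓ₁ ℓ₂) (Γ : MarkedNetwork ℝ) →
    let open CompleteOrderedField ℝ
        open MarkedNetwork Γ
        _≋ⱽ_ = _≋_ ℝ {#V}
    in
    Gainy → (sinks : AllSinksMarked) →
    let φ = transfer sinks in
    PiecewiseLinear ℝ φ ×
    IsBijection _≋ⱽ_ _≋ⱽ_ φ ×
    Σ (∀ {v} → 𝒲 (inj₁ v) → (V → Carrier) → Carrier) λ Σ[_] →
    Σ ((V → Carrier) → (V → Carrier)) λ ψ →
      (∀ {v} (W : 𝒲 (inj₁ v)) y → HasΣ y W (Σ[ W ] y)) ×
      (∀ y v → IsSupremum _≤_ (λ s → ∃ λ (W : 𝒲 (inj₁ v)) → s ≈ Σ[ W ] y) (ψ y v)) ×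
      IsInverse _≋ⱽ_ _≋ⱽ_ φ ψ
theorem3p5 em ℝ Γ gainy sinks =
  componentwise φ transfer-scalarPiecewiseLinear ,
  record
    { isInjection = record { isCongruent = isCongruent ; injective = transfer-injective }
    ; surjective = λ y → ψ y , λ x≋ψy → φ-inverse x≋ψy } ,
  (λ W y → value y W) , ψ ,
  (λ W y → hasΣ y W) , (λ y v → supremum y v .proj₂) ,
  record
    { isLeftInverse = record
      { isCongruent = isCongruent
      -- ψ respects equality because its values at y and y′ have equal images under the injective φ.
      ; from-cong = λ {y} {y′} y≋y′ → transfer-injective λ v →
          ≈-trans (transfer-ψ y v) (≈-trans (y≋y′ v) (≈-sym (transfer-ψ y′ v)))
      ; inverseˡ = φ-inverse }
    -- That ψ undoes φ follows from the other composite by cancelling the injective φ.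
    ; inverseʳ = λ {x} {y} y≋φx → transfer-injective λ v → ≈-trans (transfer-ψ y v) (y≋φx v) }
  where
  open CompleteOrderedField ℝ using (_≈_; ≈-sym; ≈-trans; setoid)
  open Equality setoid using (≋-isEquivalence)
  open Inverse em ℝ Γ gainy sinks
  open Values
  open Transfer em ℝ Γ gainy sinks
  open PiecewiseLinearMaps ℝ
  open MarkedNetwork Γ using (transfer)
  φ = transfer sinks
  isCongruent = record
    { cong = transfer-cong ; isEquivalence₁ = ≋-isEquivalence _ ; isEquivalence₂ = ≋-isEquivalence _ }
  φ-inverse : ∀ {y x} → (∀ v → x v ≈ ψ y v) → ∀ v → φ x v ≈ y v
  φ-inverse {y} x≋ψy v = ≈-trans (transfer-cong x≋ψy v) (transfer-ψ y v)
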